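{- For every odd integer $d\ge 3$ and every prime power $q\ge d+2$, $$M(q,q-d)\ \ge\ \mathcal{S}_d(q).$$
   Context: For permutations $\pi,\sigma$ of the same $n$ symbols, the Hamming distance $hd(\pi,\sigma)$ is the number of positions $x$ with $\pi(x)\ne\sigma(x)$. $M(n,D)$ is the maximum size of a set of permutations on $n$ symbols in which any two distinct permutations have Hamming distance at least $D$. Let $q$ be a prime power, $\mathbb{F}_q$ the field with $q$ elements and $\mathcal{P}^1(\mathbb{F}_q)=\mathbb{F}_q\cup\{\infty\}$. Let $V,U$ be nonzero polynomials over $\mathbb{F}_q$ with $\gcd(V,U)=1$, of degrees $v,u$ and leading coefficients $a_v,b_u$. The rational function $V(x)/U(x)$ is evaluated on $\mathcal{P}^1(\mathbb{F}_q)$ as follows: at $a\in\mathbb{F}_q$ its value is $V(a)/U(a)$, understood as $\infty$ if $U(a)=0$; at $\infty$ its value is $\infty$ if $v>u$, $0$ if $v<u$, and $a_v/b_v$ if $v=u$. It is a permutation rational function (PRF) if it permutes $\mathcal{P}^1(\mathbb{F}_q)$. $P_{v,u}(q)$ is the set of PRFs $V(x)/U(x)$ (as rational functions, so $V/U$ and $(cV)/(cU)$ with $c\in\mathbb{F}_q\setminus\{0\}$ are the same element) with $\deg V=v$ and $\deg U=u$, and $N_{v,u}(q)=|P_{v,u}(q)|$. For odd $d$, $\mathcal{S}_d(q)=\sum N_{v,u}(q)$, the sum being over all pairs $(v,u)$ of non-negative integers such that: $v\le (d+1)/2$ if $v>u$; $u\le (d-3)/2$ if $v<u$; and $v=u\le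 (d-3)/2$ if $v=u$. -}

module Defs where

open import Level using (Level; _⊔_; 0ℓ) renaming (suc to lsuc)
open import Algebra.Bundles using (CommutativeRing; Semiring)
import Algebra.Definitions
open import Algebra.Definitions.RawMagma using (_,_)
open import Data.Empty using (⊥-elim)
open import Data.Fin.Base using (Fin; zero; suc; toℕ)
open import Data.Fin.Permutation as Perm using (Permutation′; permutation; _⟨$⟩ʳ_; _⟨$⟩ˡ_)
import Data.Fin.Properties as Fin
open import Data.List.Base as List using (List; []; _∷_; length; filter; deduplicate; lookup; cartesianProduct; cartesianProductWith; upTo)
import Data.List.Membership.Propositional.Properties as List
import Data.List.Membership.Setoid as Membership
import Data.List.Membership.Setoid.Properties as Membershipₚ
open import Data.List.Relation.Unary.All as All using ([]; _∷_)
open import Data.List.Relation.Unary.AllPairs using ([]; _∷_)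
open import Data.List.Relation.Unary.Any as Any using (Any; here; there; index)
import Data.List.Relation.Unary.Any.Properties as Any
open import Data.List.Relation.Unary.Enumerates.Setoid using (IsEnumeration)
import Data.List.Relation.Unary.Enumerates.Setoid.Properties as Enum
open import Data.List.Relation.Unary.Unique.Setoid using (Unique)
open import Data.List.Relation.Unary.Unique.DecSetoid.Properties using (deduplicate-!)
open import Data.Maybe.Base using (just; nothing)
open import Data.Maybe.Relation.Binary.Pointwise as Maybe using (just; nothing)
open import Data.Nat.Base as ℕ using (ℕ; zero; suc; z≤n; s≤s)
import Data.Nat.DivMod as ℕ
import Data.Nat.ListAction as ℕ
import Data.Nat.Properties as ℕ
open import Data.Nat.Primality using (Prime)
open import Data.Product.Base as Product using (Σ; ∃; ∃₂; _×_; _,_; proj₁; proj₂)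
open import Data.Product.Relation.Binary.Pointwise.NonDependent using (_×ₛ_)
open import Data.Sum.Base using (_⊎_; inj₁; inj₂)
import Data.Vec.Functional as Vector
import Data.Vec.Functional.Relation.Binary.Equality.Setoid as Vector
open import Function.Base using (_∘_)
open import Function.Bundles using (Inverse)
open import Function.Definitions using (Congruent; Bijective)
open import Relation.Binary.Bundles using (Setoid; DecSetoid)
open import Relation.Binary.Definitions using (tri<; tri≈; tri>)
open import Relation.Binary.PropositionalEquality as ≡ using (_≡_; _≢_)
import Relation.Binary.Reasoning.Setoid
open import Relation.Nullary using (¬_; Dec; yes; no; contradiction)
open import Relation.Nullary.Decidable using (¬?; map′; _×-dec_; _→-dec_; _⊎-dec_)
open import Relation.Unary using (Pred; Decidable)

private
  variable
    a b ℓ ℓ₁ ℓ₂ p : Level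

HasCardinality : Setoid a ℓ → ℕ → Set (a ⊔ ℓ)
HasCardinality S n = Inverse S (≡.setoid (Fin n))

module _ (S : Setoid a ℓ) where
  open Setoid S

  Enumerable : Set (a ⊔ ℓ)
  Enumerable = ∃ (IsEnumeration S)

  unique⇒lookup-injective : ∀ {xs} → Unique S xs → ∀ i j →
                            lookup xs i ≈ lookup xs j → i ≡ j
  unique⇒lookup-injective (_ ∷ _)   zero    zero    _  = ≡.refl
  unique⇒lookup-injective (x∉ ∷ _)  zero    (suc j) eq = contradiction eq (All.lookup x∉ (List.∈-lookup j))
  unique⇒lookup-injective (x∉ ∷ _)  (suc i) zero    eq = contradiction (sym eq) (All.lookup x∉ (List.∈-lookup i))
  unique⇒lookup-injective (_ ∷ xs!) (suc i) (suc j) eq = ≡.cong suc (unique⇒lookup-injective xs! i j eq)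

  enumerable⇒any? : Enumerable → {P : Pred Carrier p} → (∀ {x y} → x ≈ y → P x → P y) →
                    Decidable P → Dec (∃ P)
  enumerable⇒any? (xs , x∈xs) resp P? =
    map′ Any.satisfied (λ (x , px) → Any.map (λ eq → resp eq px) (x∈xs x)) (Any.any? P? xs)

  enumerable⇒all? : Enumerable → {P : Pred Carrier p} → (∀ {x y} → x ≈ y → P x → P y) →
                    Decidable P → Dec (∀ x → P x)
  enumerable⇒all? (xs , x∈xs) resp P? =
    map′ (λ all x → All.lookupWith (λ (py) eq → resp (sym eq) py) all (x∈xs x))
         (λ all → All.tabulate (λ {x} _ → all x))
         (All.all? P? xs)

  finToEnumerable : ∀ {n} → HasCardinality S n → Enumerable
  finToEnumerable {n} inv = List.tabulate from , λ x →
      Membershipₚ.∈-resp-≈ S (inverseʳ ≡.refl) (Membershipₚ.∈-tabulate⁺ S (to x))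
    where open Inverse inv

enumerable⇒cardinality : (S : DecSetoid a ℓ) → Enumerable (DecSetoid.setoid S) →
                         ∃ (HasCardinality (DecSetoid.setoid S))
enumerable⇒cardinality S (xs , x∈xs) = length ys , record
  { to        = λ x → index (y∈ys x)
  ; from      = lookup ys
  ; to-cong   = λ {x} {y} x≈y → inj (trans (sym (Any.lookup-index (y∈ys x))) (trans x≈y (Any.lookup-index (y∈ys y))))
  ; from-cong = λ { ≡.refl → refl }
  ; inverse   = (λ {i} {x} x≈ → inj (trans (sym (Any.lookup-index (y∈ys x))) x≈))
              , (λ { {x} ≡.refl → sym (Any.lookup-index (y∈ys x)) })
  }
  where
  open DecSetoid S
  ys = deduplicate _≟_ xs
  y∈ys : IsEnumeration setoid ys
  y∈ys = Enum.deduplicate⁺ S x∈xs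
  inj : ∀ {i j} → lookup ys i ≈ lookup ys j → i ≡ j
  inj = unique⇒lookup-injective setoid (deduplicate-! S xs) _ _

vectorsEnumerable : (S : Setoid a ℓ) → Enumerable S → ∀ n → Enumerable (Vector.≋-setoid S n)
vectorsEnumerable S en zero = (λ ()) ∷ [] , λ _ → here (λ ())
vectorsEnumerable S (xs , x∈xs) (suc n) with vectorsEnumerable S (xs , x∈xs) n
... | fs , f∈fs = cartesianProductWith Vector._∷_ xs fs , λ f →
  Membershipₚ.∈-resp-≈ (Vector.≋-setoid S (suc n)) {x = Vector.head f Vector.∷ Vector.tail f}
    (λ { zero → Setoid.refl S ; (suc i) → Setoid.refl S })
    (Membershipₚ.∈-cartesianProductWith⁺ S (Vector.≋-setoid S n) (Vector.≋-setoid S (suc n))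
      (λ { eq eqs zero → eq ; eq eqs (suc i) → eqs i })
      (x∈xs (f zero)) (f∈fs (f ∘ suc)))

module _ {S : Setoid a ℓ₁} (T : Setoid b ℓ₂) where
  private
    module S = Setoid S
    module T = Setoid T

  enumerablePart : Enumerable S → {P : Pred S.Carrier p} → Decidable P →
                   (build : ∀ s → P s → T.Carrier) →
                   (∀ t → ∃ λ s → ∀ {s′} → s S.≈ s′ → P s′ × (∀ p → t T.≈ build s′ p)) →
                   Enumerable T
  enumerablePart (xs , x∈xs) {P} P? build complete = go xs , λ t →
      let s , good = complete t in ∈-go (Any.map good (x∈xs s))
    where
    go : List S.Carrier → List T.Carrier
    go [] = []
    go (s ∷ ss) with P? s
    ... | yes p = build s p ∷ go ss
    ... | no _  = go ss
    open Membership T using (_∈_)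
    ∈-go : ∀ {t ss} → Any (λ s → P s × (∀ p → t T.≈ build s p)) ss → t ∈ go ss
    ∈-go {ss = s ∷ ss} any with P? s
    ∈-go (here (_ , eq)) | yes p = here (eq p)
    ∈-go (here (p , _))  | no ¬p = contradiction p ¬p
    ∈-go (there any)     | yes _ = there (∈-go any)
    ∈-go (there any)     | no _  = ∈-go any

greatest : {P : Pred ℕ p} → Decidable P → P 0 → (b : ℕ) → (∀ k → P k → k ℕ.≤ b) →
           ∃ λ m → P m × (∀ k → P k → k ℕ.≤ m)
greatest {P = P} P? P0 zero bound = 0 , P0 , bound
greatest {P = P} P? P0 (suc b) bound with P? (suc b)
... | yes Pb = suc b , Pb , bound
... | no ¬Pb = greatest P? P0 b λ k Pk →
      ℕ.≤-pred (ℕ.≤∧≢⇒< (bound k Pk) λ { ≡.refl → ¬Pb Pk })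

hd : ∀ {n} → Permutation′ n → Permutation′ n → ℕ
hd {n} π σ = length (filter (λ x → ¬? (π ⟨$⟩ʳ x Fin.≟ σ ⟨$⟩ʳ x)) (List.allFin n))

-- A set of k permutations is given by listing its k distinct members.
record IsPermutationArray {n k : ℕ} (D : ℕ) (π : Fin k → Permutation′ n) : Set where
  field
    distinct : ∀ i j → i ≢ j → ¬ (π i Perm.≈ π j)
    distance : ∀ i j → ¬ (π i Perm.≈ π j) → D ℕ.≤ hd (π i) (π j)

PermutationArray : (n D k : ℕ) → Set
PermutationArray n D k = ∃ λ (π : Fin k → Permutation′ n) → IsPermutationArray D π

permutations : ℕ → DecSetoid 0ℓ 0ℓ
permutations n = record
  { Carrier = Permutation′ n
  ; _≈_     = Perm._≈_
  ; isDecEquivalence = record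
    { isEquivalence = record
      { refl  = λ _ → ≡.refl
      ; sym   = λ eq i → ≡.sym (eq i)
      ; trans = λ eq₁ eq₂ i → ≡.trans (eq₁ i) (eq₂ i)
      }
    ; _≟_ = λ π σ → Fin.all? λ i → π ⟨$⟩ʳ i Fin.≟ σ ⟨$⟩ʳ i
    }
  }

permutationsEnumerable : ∀ n → Enumerable (DecSetoid.setoid (permutations n))
permutationsEnumerable n = enumerablePart {S = F ×ₛ F} (DecSetoid.setoid (permutations n))
    (Product.map (λ fs → List.cartesianProduct fs fs) (λ f∈ → Enum.cartesianProduct⁺ F F f∈ f∈) fns)
    (λ (f , g) → Fin.all? (λ i → f (g i) Fin.≟ i) ×-dec Fin.all? (λ i → g (f i) Fin.≟ i))
    (λ (f , g) (l , r) → permutation f g l r)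
    λ π → ((π ⟨$⟩ʳ_) , (π ⟨$⟩ˡ_)) , λ { {f , g} (f≈ , g≈) →
      ( (λ i → ≡.trans (≡.sym (f≈ (g i))) (≡.trans (≡.cong (π ⟨$⟩ʳ_) (≡.sym (g≈ i))) (Perm.inverseʳ π)))
      , (λ i → ≡.trans (≡.sym (g≈ (f i))) (≡.trans (≡.cong (π ⟨$⟩ˡ_) (≡.sym (f≈ i))) (Perm.inverseˡ π))))
      , (λ _ → f≈) }
  where
  F = Vector.≋-setoid (≡.setoid (Fin n)) n
  fns : Enumerable F
  fns = vectorsEnumerable (≡.setoid (Fin n)) (List.allFin n , List.∈-allFin) n

hd-cong : ∀ {n} {π π′ σ σ′ : Permutation′ n} → π Perm.≈ π′ → σ Perm.≈ σ′ → hd π σ ≡ hd π′ σ′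
hd-cong {n} {π} {π′} {σ} {σ′} π≈ σ≈ = go (List.allFin n)
  where
  go : ∀ xs → length (filter (λ x → ¬? (π ⟨$⟩ʳ x Fin.≟ σ ⟨$⟩ʳ x)) xs) ≡
              length (filter (λ x → ¬? (π′ ⟨$⟩ʳ x Fin.≟ σ′ ⟨$⟩ʳ x)) xs)
  go [] = ≡.refl
  go (x ∷ xs) rewrite π≈ x | σ≈ x with π′ ⟨$⟩ʳ x Fin.≟ σ′ ⟨$⟩ʳ x
  ... | yes _ = go xs
  ... | no _  = ≡.cong suc (go xs)

permutationArray? : ∀ n D k → Dec (PermutationArray n D k)
permutationArray? n D k =
  enumerable⇒any? (Vector.≋-setoid (DecSetoid.setoid (permutations n)) k)
    (vectorsEnumerable (DecSetoid.setoid (permutations n)) (permutationsEnumerable n) k)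
    (λ {π} {ρ} eq arr → let open IsPermutationArray arr in record
      { distinct = λ i j i≢j ρ≈ → distinct i j i≢j λ x →
          ≡.trans (eq i x) (≡.trans (ρ≈ x) (≡.sym (eq j x)))
      ; distance = λ i j ρ≉ → ≡.subst (D ℕ.≤_)
          (hd-cong {π = π i} {ρ i} {π j} {ρ j} (eq i) (eq j))
          (distance i j λ π≈ → ρ≉ λ x → ≡.trans (≡.sym (eq i x)) (≡.trans (π≈ x) (eq j x)))
      })
    λ π → map′ (λ (di , da) → record { distinct = di ; distance = da })
               (λ arr → IsPermutationArray.distinct arr , IsPermutationArray.distance arr)
      ((Fin.all? λ i → Fin.all? λ j → ¬? (i Fin.≟ j) →-dec ¬? (π i ≟ π j))
       ×-dec (Fin.all? λ i → Fin.all? λ j → ¬? (π i ≟ π j) →-dec (D ℕ.≤? hd (π i) (π j))))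
  where open DecSetoid (permutations n) using (_≟_)

IsMaximumSize : (n D m : ℕ) → Set
IsMaximumSize n D m = PermutationArray n D m × (∀ k → PermutationArray n D k → k ℕ.≤ m)

maximumSize : ∀ n D → ∃ (IsMaximumSize n D)
maximumSize n D with enumerable⇒cardinality (permutations n) (permutationsEnumerable n)
... | N , inv = greatest (permutationArray? n D) ((λ ()) , record { distinct = λ () ; distance = λ () }) N
  λ k (π , arr) → Fin.injective⇒≤ {f = Inverse.to inv ∘ π} λ {i} {j} eq → bound arr eq
  where
  bound : ∀ {k} {π : Fin k → Permutation′ n} {i j} → IsPermutationArray D π →
          Inverse.to inv (π i) ≡ Inverse.to inv (π j) → i ≡ j
  bound {π = π} {i} {j} arr eq with i Fin.≟ j
  ... | yes i≡j = i≡j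
  ... | no i≢j  = ⊥-elim (IsPermutationArray.distinct arr i j i≢j
        λ x → ≡.trans (≡.sym (Inverse.inverseʳ inv {π i} ≡.refl x)) (Inverse.inverseʳ inv {π j} eq x))

M : ℕ → ℕ → ℕ
M n D = proj₁ (maximumSize n D)

module Polynomials {c ℓ} (R : CommutativeRing c ℓ) where
  open CommutativeRing R hiding (zero)
  open import Algebra.Properties.Ring ring using (-0#≈0#)
  open import Algebra.Properties.CommutativeSemigroup +-commutativeSemigroup using (x∙yz≈y∙xz; interchange)
  open import Algebra.Properties.CommutativeSemigroup *-commutativeSemigroup
    using () renaming (x∙yz≈y∙xz to x*yz≈y*xz)
  open import Relation.Binary.Reasoning.Setoid setoid

  -- a₀ ∷ a₁ ∷ … stands for a₀ + a₁ X + …; trailing zeros are allowed.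
  Poly : Set c
  Poly = List Carrier

  coeff : Poly → ℕ → Carrier
  coeff []      _       = 0#
  coeff (a ∷ p) zero    = a
  coeff (a ∷ p) (suc i) = coeff p i

  infix 4 _≈ₚ_
  record _≈ₚ_ (p q : Poly) : Set ℓ where
    constructor coeffs
    field coeff-≈ : ∀ i → coeff p i ≈ coeff q i
  open _≈ₚ_ public

  infixl 6 _+ₚ_
  infixl 7 _*ₚ_ _·_
  infix  8 -ₚ_

  0ₚ 1ₚ : Poly
  0ₚ = []
  1ₚ = 1# ∷ []

  _+ₚ_ : Poly → Poly → Poly
  []      +ₚ q       = q
  (a ∷ p) +ₚ []      = a ∷ p
  (a ∷ p) +ₚ (b ∷ q) = (a + b) ∷ (p +ₚ q)

  -ₚ_ : Poly → Poly
  -ₚ_ = List.map (-_)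

  _·_ : Carrier → Poly → Poly
  a · p = List.map (a *_) p

  _*ₚ_ : Poly → Poly → Poly
  []      *ₚ q = []
  (a ∷ p) *ₚ q = a · q +ₚ (0# ∷ p *ₚ q)

  eval : Poly → Carrier → Carrier
  eval []      x = 0#
  eval (a ∷ p) x = a + x * eval p x

  Bounded : Poly → ℕ → Set ℓ
  Bounded p n = ∀ i → n ℕ.< i → coeff p i ≈ 0#

  HasDegree : Poly → ℕ → Set ℓ
  HasDegree p n = ¬ coeff p n ≈ 0# × Bounded p n

  coeff-+ : ∀ p q i → coeff (p +ₚ q) i ≈ coeff p i + coeff q i
  coeff-+ []      q       i       = sym (+-identityˡ _)
  coeff-+ (a ∷ p) []      i       = sym (+-identityʳ _)
  coeff-+ (a ∷ p) (b ∷ q) zero    = refl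
  coeff-+ (a ∷ p) (b ∷ q) (suc i) = coeff-+ p q i

  coeff-neg : ∀ p i → coeff (-ₚ p) i ≈ - coeff p i
  coeff-neg []      i       = sym -0#≈0#
  coeff-neg (a ∷ p) zero    = refl
  coeff-neg (a ∷ p) (suc i) = coeff-neg p i

  coeff-· : ∀ a p i → coeff (a · p) i ≈ a * coeff p i
  coeff-· a []      i       = sym (zeroʳ a)
  coeff-· a (b ∷ p) zero    = refl
  coeff-· a (b ∷ p) (suc i) = coeff-· a p i

  ≈ₚ-refl : ∀ {p} → p ≈ₚ p
  ≈ₚ-refl = coeffs λ _ → refl

  ≈ₚ-sym : ∀ {p q} → p ≈ₚ q → q ≈ₚ p
  ≈ₚ-sym (coeffs eq) = coeffs λ i → sym (eq i)

  ≈ₚ-trans : ∀ {p q r} → p ≈ₚ q → q ≈ₚ r → p ≈ₚ r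
  ≈ₚ-trans (coeffs eq₁) (coeffs eq₂) = coeffs λ i → trans (eq₁ i) (eq₂ i)

  polySetoid : Setoid c ℓ
  polySetoid = record { Carrier = Poly ; _≈_ = _≈ₚ_ ; isEquivalence = record { refl = ≈ₚ-refl ; sym = ≈ₚ-sym ; trans = ≈ₚ-trans } }

  ∷-cong : ∀ {a b p q} → a ≈ b → p ≈ₚ q → a ∷ p ≈ₚ b ∷ q
  ∷-cong a≈b (coeffs eq) = coeffs λ { zero → a≈b ; (suc i) → eq i }

  0∷0 : 0# ∷ 0ₚ ≈ₚ 0ₚ
  0∷0 = coeffs λ { zero → refl ; (suc i) → refl }

  +ₚ-cong : ∀ {p p′ q q′} → p ≈ₚ p′ → q ≈ₚ q′ → p +ₚ q ≈ₚ p′ +ₚ q′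
  +ₚ-cong {p} {p′} {q} {q′} (coeffs e) (coeffs e′) = coeffs λ i →
    trans (coeff-+ p q i) (trans (+-cong (e i) (e′ i)) (sym (coeff-+ p′ q′ i)))

  -ₚ-cong : ∀ {p q} → p ≈ₚ q → -ₚ p ≈ₚ -ₚ q
  -ₚ-cong {p} {q} (coeffs e) = coeffs λ i →
    trans (coeff-neg p i) (trans (-‿cong (e i)) (sym (coeff-neg q i)))

  ·-cong : ∀ {a b p q} → a ≈ b → p ≈ₚ q → a · p ≈ₚ b · q
  ·-cong {a} {b} {p} {q} a≈b (coeffs e) = coeffs λ i →
    trans (coeff-· a p i) (trans (*-cong a≈b (e i)) (sym (coeff-· b q i)))

  +ₚ-comm : ∀ p q → p +ₚ q ≈ₚ q +ₚ p
  +ₚ-comm p q = coeffs λ i → trans (coeff-+ p q i) (trans (+-comm _ _) (sym (coeff-+ q p i)))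

  +ₚ-assoc : ∀ p q r → (p +ₚ q) +ₚ r ≈ₚ p +ₚ (q +ₚ r)
  +ₚ-assoc p q r = coeffs λ i → begin
    coeff ((p +ₚ q) +ₚ r) i             ≈⟨ coeff-+ (p +ₚ q) r i ⟩
    coeff (p +ₚ q) i + coeff r i        ≈⟨ +-congʳ (coeff-+ p q i) ⟩
    coeff p i + coeff q i + coeff r i   ≈⟨ +-assoc _ _ _ ⟩
    coeff p i + (coeff q i + coeff r i) ≈⟨ +-congˡ (coeff-+ q r i) ⟨
    coeff p i + coeff (q +ₚ r) i        ≈⟨ coeff-+ p (q +ₚ r) i ⟨
    coeff (p +ₚ (q +ₚ r)) i             ∎

  +ₚ-identityʳ : ∀ p → p +ₚ 0ₚ ≈ₚ p
  +ₚ-identityʳ p = +ₚ-comm p 0ₚ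

  +ₚ-inverseˡ : ∀ p → (-ₚ p) +ₚ p ≈ₚ 0ₚ
  +ₚ-inverseˡ p = coeffs λ i →
    trans (coeff-+ (-ₚ p) p i) (trans (+-congʳ (coeff-neg p i)) (-‿inverseˡ _))

  private
    module PR = Relation.Binary.Reasoning.Setoid polySetoid

    +-swap : ∀ p q r s → (p +ₚ q) +ₚ (r +ₚ s) ≈ₚ (p +ₚ r) +ₚ (q +ₚ s)
    +-swap p q r s = coeffs λ i → begin
      coeff ((p +ₚ q) +ₚ (r +ₚ s)) i                      ≈⟨ expand p q r s i ⟩
      (coeff p i + coeff q i) + (coeff r i + coeff s i)   ≈⟨ interchange _ _ _ _ ⟩
      (coeff p i + coeff r i) + (coeff q i + coeff s i)   ≈⟨ expand p r q s i ⟨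
      coeff ((p +ₚ r) +ₚ (q +ₚ s)) i                      ∎
      where
      expand : ∀ p q r s i → coeff ((p +ₚ q) +ₚ (r +ₚ s)) i ≈
                             (coeff p i + coeff q i) + (coeff r i + coeff s i)
      expand p q r s i = trans (coeff-+ (p +ₚ q) (r +ₚ s) i) (+-cong (coeff-+ p q i) (coeff-+ r s i))

    +-left-comm : ∀ p q r → p +ₚ (q +ₚ r) ≈ₚ q +ₚ (p +ₚ r)
    +-left-comm p q r = ≈ₚ-trans (≈ₚ-sym (+ₚ-assoc p q r))
      (≈ₚ-trans (+ₚ-cong (+ₚ-comm p q) ≈ₚ-refl) (+ₚ-assoc q p r))

    ·-distribˡ : ∀ a p q → a · (p +ₚ q) ≈ₚ a · p +ₚ a · q
    ·-distribˡ a p q = coeffs λ i → begin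
      coeff (a · (p +ₚ q)) i              ≈⟨ coeff-· a (p +ₚ q) i ⟩
      a * coeff (p +ₚ q) i                ≈⟨ *-congˡ (coeff-+ p q i) ⟩
      a * (coeff p i + coeff q i)         ≈⟨ distribˡ a _ _ ⟩
      a * coeff p i + a * coeff q i       ≈⟨ +-cong (coeff-· a p i) (coeff-· a q i) ⟨
      coeff (a · p) i + coeff (a · q) i   ≈⟨ coeff-+ (a · p) (a · q) i ⟨
      coeff (a · p +ₚ a · q) i            ∎

    ·-distribʳ : ∀ a b p → (a + b) · p ≈ₚ a · p +ₚ b · p
    ·-distribʳ a b p = coeffs λ i → begin
      coeff ((a + b) · p) i               ≈⟨ coeff-· (a + b) p i ⟩
      (a + b) * coeff p i                 ≈⟨ distribʳ _ a b ⟩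
      a * coeff p i + b * coeff p i       ≈⟨ +-cong (coeff-· a p i) (coeff-· b p i) ⟨
      coeff (a · p) i + coeff (b · p) i   ≈⟨ coeff-+ (a · p) (b · p) i ⟨
      coeff (a · p +ₚ b · p) i            ∎

    ·-assoc : ∀ a b p → (a * b) · p ≈ₚ a · (b · p)
    ·-assoc a b p = coeffs λ i → begin
      coeff ((a * b) · p) i   ≈⟨ coeff-· (a * b) p i ⟩
      (a * b) * coeff p i     ≈⟨ *-assoc a b _ ⟩
      a * (b * coeff p i)     ≈⟨ *-congˡ (coeff-· b p i) ⟨
      a * coeff (b · p) i     ≈⟨ coeff-· a (b · p) i ⟨
      coeff (a · (b · p)) i   ∎

    1·-identity : ∀ p → 1# · p ≈ₚ p
    1·-identity p = coeffs λ i → trans (coeff-· 1# p i) (*-identityˡ _)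

    0·-zero : ∀ {a} p → a ≈ 0# → a · p ≈ₚ 0ₚ
    0·-zero {a} p a≈0 = coeffs λ i → trans (coeff-· a p i) (trans (*-congʳ a≈0) (zeroˡ _))

    ·-* : ∀ a p q → a · (p *ₚ q) ≈ₚ (a · p) *ₚ q
    ·-* a []      q = ≈ₚ-refl
    ·-* a (b ∷ p) q = PR.begin
      a · (b · q +ₚ (0# ∷ p *ₚ q))          PR.≈⟨ ·-distribˡ a (b · q) (0# ∷ p *ₚ q) ⟩
      a · (b · q) +ₚ (a * 0# ∷ a · (p *ₚ q)) PR.≈⟨ +ₚ-cong (≈ₚ-sym (·-assoc a b q)) (∷-cong (zeroʳ a) (·-* a p q)) ⟩
      (a * b) · q +ₚ (0# ∷ (a · p) *ₚ q)    PR.∎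

    0∷-+ : ∀ p q → 0# ∷ (p +ₚ q) ≈ₚ (0# ∷ p) +ₚ (0# ∷ q)
    0∷-+ p q = ∷-cong (sym (+-identityˡ 0#)) ≈ₚ-refl

    0∷-* : ∀ p q → (0# ∷ p) *ₚ q ≈ₚ 0# ∷ p *ₚ q
    0∷-* p q = +ₚ-cong (0·-zero q refl) ≈ₚ-refl

  *ₚ-zeroʳ : ∀ p → p *ₚ 0ₚ ≈ₚ 0ₚ
  *ₚ-zeroʳ []      = ≈ₚ-refl
  *ₚ-zeroʳ (a ∷ p) = ≈ₚ-trans (∷-cong refl (*ₚ-zeroʳ p)) 0∷0

  *ₚ-∷ʳ : ∀ p b q → p *ₚ (b ∷ q) ≈ₚ b · p +ₚ (0# ∷ p *ₚ q)
  *ₚ-∷ʳ []      b q = ≈ₚ-sym 0∷0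
  *ₚ-∷ʳ (a ∷ p) b q = ∷-cong (+-congʳ (*-comm a b)) (PR.begin
    a · q +ₚ (p *ₚ (b ∷ q))           PR.≈⟨ +ₚ-cong ≈ₚ-refl (*ₚ-∷ʳ p b q) ⟩
    a · q +ₚ (b · p +ₚ (0# ∷ p *ₚ q)) PR.≈⟨ +-left-comm (a · q) (b · p) (0# ∷ p *ₚ q) ⟩
    b · p +ₚ (a · q +ₚ (0# ∷ p *ₚ q)) PR.∎)

  *ₚ-comm : ∀ p q → p *ₚ q ≈ₚ q *ₚ p
  *ₚ-comm []      q = ≈ₚ-sym (*ₚ-zeroʳ q)
  *ₚ-comm (a ∷ p) q = ≈ₚ-trans (+ₚ-cong ≈ₚ-refl (∷-cong refl (*ₚ-comm p q))) (≈ₚ-sym (*ₚ-∷ʳ q a p))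

  *ₚ-congˡ : ∀ p {q q′} → q ≈ₚ q′ → p *ₚ q ≈ₚ p *ₚ q′
  *ₚ-congˡ []      eq = ≈ₚ-refl
  *ₚ-congˡ (a ∷ p) eq = +ₚ-cong (·-cong refl eq) (∷-cong refl (*ₚ-congˡ p eq))

  *ₚ-cong : ∀ {p p′ q q′} → p ≈ₚ p′ → q ≈ₚ q′ → p *ₚ q ≈ₚ p′ *ₚ q′
  *ₚ-cong {p} {p′} {q} {q′} eq eq′ = PR.begin
    p *ₚ q   PR.≈⟨ *ₚ-congˡ p eq′ ⟩
    p *ₚ q′  PR.≈⟨ *ₚ-comm p q′ ⟩
    q′ *ₚ p  PR.≈⟨ *ₚ-congˡ q′ eq ⟩
    q′ *ₚ p′ PR.≈⟨ *ₚ-comm q′ p′ ⟩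
    p′ *ₚ q′ PR.∎

  *ₚ-distribʳ : ∀ r p q → (p +ₚ q) *ₚ r ≈ₚ p *ₚ r +ₚ q *ₚ r
  *ₚ-distribʳ r []      q       = ≈ₚ-refl
  *ₚ-distribʳ r (a ∷ p) []      = ≈ₚ-sym (+ₚ-identityʳ _)
  *ₚ-distribʳ r (a ∷ p) (b ∷ q) = PR.begin
    (a + b) · r +ₚ (0# ∷ (p +ₚ q) *ₚ r)
      PR.≈⟨ +ₚ-cong (·-distribʳ a b r) (≈ₚ-trans (∷-cong refl (*ₚ-distribʳ r p q)) (0∷-+ (p *ₚ r) (q *ₚ r))) ⟩
    (a · r +ₚ b · r) +ₚ ((0# ∷ p *ₚ r) +ₚ (0# ∷ q *ₚ r))
      PR.≈⟨ +-swap (a · r) (b · r) (0# ∷ p *ₚ r) (0# ∷ q *ₚ r) ⟩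
    (a · r +ₚ (0# ∷ p *ₚ r)) +ₚ (b · r +ₚ (0# ∷ q *ₚ r)) PR.∎

  *ₚ-distribˡ : ∀ r p q → r *ₚ (p +ₚ q) ≈ₚ r *ₚ p +ₚ r *ₚ q
  *ₚ-distribˡ r p q = PR.begin
    r *ₚ (p +ₚ q)     PR.≈⟨ *ₚ-comm r (p +ₚ q) ⟩
    (p +ₚ q) *ₚ r     PR.≈⟨ *ₚ-distribʳ r p q ⟩
    p *ₚ r +ₚ q *ₚ r  PR.≈⟨ +ₚ-cong (*ₚ-comm p r) (*ₚ-comm q r) ⟩
    r *ₚ p +ₚ r *ₚ q  PR.∎

  *ₚ-assoc : ∀ p q r → (p *ₚ q) *ₚ r ≈ₚ p *ₚ (q *ₚ r)
  *ₚ-assoc []      q r = ≈ₚ-refl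
  *ₚ-assoc (a ∷ p) q r = PR.begin
    (a · q +ₚ (0# ∷ p *ₚ q)) *ₚ r           PR.≈⟨ *ₚ-distribʳ r (a · q) (0# ∷ p *ₚ q) ⟩
    (a · q) *ₚ r +ₚ (0# ∷ p *ₚ q) *ₚ r      PR.≈⟨ +ₚ-cong (≈ₚ-sym (·-* a q r)) (0∷-* (p *ₚ q) r) ⟩
    a · (q *ₚ r) +ₚ (0# ∷ (p *ₚ q) *ₚ r)    PR.≈⟨ +ₚ-cong ≈ₚ-refl (∷-cong refl (*ₚ-assoc p q r)) ⟩
    a · (q *ₚ r) +ₚ (0# ∷ p *ₚ (q *ₚ r))    PR.∎

  *ₚ-identityˡ : ∀ p → 1ₚ *ₚ p ≈ₚ p
  *ₚ-identityˡ p = PR.begin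
    1# · p +ₚ (0# ∷ []) PR.≈⟨ +ₚ-cong (1·-identity p) 0∷0 ⟩
    p +ₚ []             PR.≈⟨ +ₚ-identityʳ p ⟩
    p                   PR.∎

  polyRing : CommutativeRing c ℓ
  polyRing = record
    { Carrier = Poly
    ; _≈_ = _≈ₚ_
    ; _+_ = _+ₚ_
    ; _*_ = _*ₚ_
    ; -_  = -ₚ_
    ; 0#  = 0ₚ
    ; 1#  = 1ₚ
    ; isCommutativeRing = record
      { isRing = record
        { +-isAbelianGroup = record
          { isGroup = record
            { isMonoid = record
              { isSemigroup = record
                { isMagma = record
                  { isEquivalence = Setoid.isEquivalence polySetoid
                  ; ∙-cong = +ₚ-cong
                  }
                ; assoc = +ₚ-assoc
                }
              ; identity = (λ _ → ≈ₚ-refl) , +ₚ-identityʳ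
              }
            ; inverse = +ₚ-inverseˡ , λ p → ≈ₚ-trans (+ₚ-comm p (-ₚ p)) (+ₚ-inverseˡ p)
            ; ⁻¹-cong = -ₚ-cong
            }
          ; comm = +ₚ-comm
          }
        ; *-cong = *ₚ-cong
        ; *-assoc = *ₚ-assoc
        ; *-identity = *ₚ-identityˡ , λ p → ≈ₚ-trans (*ₚ-comm p 1ₚ) (*ₚ-identityˡ p)
        ; distrib = *ₚ-distribˡ , *ₚ-distribʳ
        }
      ; *-comm = *ₚ-comm
      }
    }

  open import Algebra.Definitions.RawSemiring (Semiring.rawSemiring (CommutativeRing.semiring polyRing)) public
    using (Coprime) renaming (_∣_ to _∣ₚ_)

  eval-zero : ∀ p x → p ≈ₚ 0ₚ → eval p x ≈ 0#
  eval-zero []      x eq = refl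
  eval-zero (a ∷ p) x (coeffs eq) = begin
    a + x * eval p x ≈⟨ +-cong (eq 0) (*-congˡ (eval-zero p x (coeffs {p} {0ₚ} λ i → eq (suc i)))) ⟩
    0# + x * 0#      ≈⟨ +-identityˡ _ ⟩
    x * 0#           ≈⟨ zeroʳ x ⟩
    0#               ∎

  eval-cong : ∀ {p q x y} → p ≈ₚ q → x ≈ y → eval p x ≈ eval q y
  eval-cong {[]}    {q}     {x} {y} eq x≈y = sym (eval-zero q y (≈ₚ-sym eq))
  eval-cong {a ∷ p} {[]}    {x} {y} eq x≈y = eval-zero (a ∷ p) x eq
  eval-cong {a ∷ p} {b ∷ q} {x} {y} (coeffs eq) x≈y =
    +-cong (eq 0) (*-cong x≈y (eval-cong {p} {q} (coeffs λ i → eq (suc i)) x≈y))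

  Bounded-resp : ∀ {p q n} → p ≈ₚ q → Bounded p n → Bounded q n
  Bounded-resp (coeffs eq) bd i n<i = trans (sym (eq i)) (bd i n<i)

  HasDegree-resp : ∀ {p q n} → p ≈ₚ q → HasDegree p n → HasDegree q n
  HasDegree-resp p≈q (≉0 , bd) =
    (λ eq0 → ≉0 (trans (coeff-≈ p≈q _) eq0)) , Bounded-resp p≈q bd

  HasDegree-unique : ∀ {p m n} → HasDegree p m → HasDegree p n → m ≡ n
  HasDegree-unique {m = m} {n} (m≉ , m>) (n≉ , n>) with ℕ.<-cmp m n
  ... | tri< m<n _ _ = contradiction (m> n m<n) n≉
  ... | tri≈ _ m≡n _ = m≡n
  ... | tri> _ _ n<m = contradiction (n> m n<m) m≉

  *ₚ-bounded : ∀ p {q m n} → Bounded p m → Bounded q n → Bounded (p *ₚ q) (m ℕ.+ n)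
  *ₚ-bounded [] bp bq i lt = refl
  *ₚ-bounded (a ∷ p) {q} {zero} {n} bp bq i lt = begin
    coeff (a · q +ₚ (0# ∷ p *ₚ q)) i           ≈⟨ coeff-+ (a · q) (0# ∷ p *ₚ q) i ⟩
    coeff (a · q) i + coeff (0# ∷ p *ₚ q) i    ≈⟨ +-cong (coeff-· a q i) (coeff-≈ (∷-cong refl (*ₚ-cong p≈0 (≈ₚ-refl {q}))) i) ⟩
    a * coeff q i + coeff (0# ∷ 0ₚ) i          ≈⟨ +-cong (*-congˡ (bq i lt)) (coeff-≈ 0∷0 i) ⟩
    a * 0# + 0#                                ≈⟨ trans (+-identityʳ _) (zeroʳ a) ⟩
    0#                                         ∎
    where
    p≈0 : p ≈ₚ 0ₚ
    p≈0 = coeffs λ i → bp (suc i) (s≤s z≤n)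
  *ₚ-bounded (a ∷ p) {q} {suc m} {n} bp bq (suc i) (s≤s lt) = begin
    coeff (a · q +ₚ (0# ∷ p *ₚ q)) (suc i)         ≈⟨ coeff-+ (a · q) (0# ∷ p *ₚ q) (suc i) ⟩
    coeff (a · q) (suc i) + coeff (p *ₚ q) i       ≈⟨ +-cong (coeff-· a q (suc i)) (*ₚ-bounded p (λ j m<j → bp (suc j) (s≤s m<j)) bq i lt) ⟩
    a * coeff q (suc i) + 0#                       ≈⟨ +-identityʳ _ ⟩
    a * coeff q (suc i)                            ≈⟨ *-congˡ (bq (suc i) (ℕ.≤-<-trans (ℕ.m≤n+m n m) (ℕ.m<n⇒m<1+n lt))) ⟩
    a * 0#                                         ≈⟨ zeroʳ a ⟩
    0#                                             ∎

  *ₚ-leading : ∀ p {q m n} → Bounded p m → Bounded q n →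
               coeff (p *ₚ q) (m ℕ.+ n) ≈ coeff p m * coeff q n
  *ₚ-leading [] bp bq = sym (zeroˡ _)
  *ₚ-leading (a ∷ p) {q} {zero} {n} bp bq = begin
    coeff (a · q +ₚ (0# ∷ p *ₚ q)) n           ≈⟨ coeff-+ (a · q) (0# ∷ p *ₚ q) n ⟩
    coeff (a · q) n + coeff (0# ∷ p *ₚ q) n    ≈⟨ +-cong (coeff-· a q n) (coeff-≈ (∷-cong refl (*ₚ-cong p≈0 (≈ₚ-refl {q}))) n) ⟩
    a * coeff q n + coeff (0# ∷ 0ₚ) n          ≈⟨ +-congˡ (coeff-≈ 0∷0 n) ⟩
    a * coeff q n + 0#                         ≈⟨ +-identityʳ _ ⟩
    a * coeff q n                              ∎
    where
    p≈0 : p ≈ₚ 0ₚ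
    p≈0 = coeffs λ i → bp (suc i) (s≤s z≤n)
  *ₚ-leading (a ∷ p) {q} {suc m} {n} bp bq = begin
    coeff (a · q +ₚ (0# ∷ p *ₚ q)) (suc m ℕ.+ n)     ≈⟨ coeff-+ (a · q) (0# ∷ p *ₚ q) (suc m ℕ.+ n) ⟩
    coeff (a · q) (suc m ℕ.+ n) + coeff (p *ₚ q) (m ℕ.+ n)
      ≈⟨ +-cong (trans (coeff-· a q (suc m ℕ.+ n)) (*-congˡ (bq _ (s≤s (ℕ.m≤n+m n m)))))
                (*ₚ-leading p (λ j m<j → bp (suc j) (s≤s m<j)) bq) ⟩
    a * 0# + coeff p m * coeff q n                   ≈⟨ trans (+-congʳ (zeroʳ a)) (+-identityˡ _) ⟩
    coeff p m * coeff q n                            ∎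

  fromVector : ∀ {n} → (Fin n → Carrier) → Poly
  fromVector = List.tabulate

  fromVector-cong : ∀ {n} {f g : Fin n → Carrier} → (∀ i → f i ≈ g i) → fromVector f ≈ₚ fromVector g
  fromVector-cong {zero}  eq = ≈ₚ-refl
  fromVector-cong {suc n} eq = ∷-cong (eq zero) (fromVector-cong (λ i → eq (suc i)))

  fromVector-bounded : ∀ {n} (f : Fin (suc n) → Carrier) → Bounded (fromVector f) n
  fromVector-bounded {zero}  f (suc i) _         = refl
  fromVector-bounded {suc n} f (suc i) (s≤s n<i) = fromVector-bounded (λ j → f (suc j)) i n<i

  coefficientVector : ∀ n → Poly → Fin n → Carrier
  coefficientVector n p i = coeff p (toℕ i)

  ≈fromVector : ∀ {n p} → Bounded p n → p ≈ₚ fromVector (coefficientVector (suc n) p)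
  ≈fromVector {n} {p} bd = coeffs (go n p (λ i → bd i))
    where
    go : ∀ n p → Bounded p n → ∀ i → coeff p i ≈ coeff (fromVector (coefficientVector (suc n) p)) i
    go n       p       bd zero    = refl
    go zero    p       bd (suc i) = bd (suc i) (s≤s z≤n)
    go (suc n) []      bd (suc i) = go n [] (λ _ _ → refl) i
    go (suc n) (a ∷ p) bd (suc i) = go n p (λ j n<j → bd (suc j) (s≤s n<j)) i

record Field c ℓ : Set (lsuc (c ⊔ ℓ)) where
  field
    commutativeRing : CommutativeRing c ℓ
  open CommutativeRing commutativeRing public
  open Algebra.Definitions _≈_ using (Invertible)
  field
    0≉1        : ¬ 0# ≈ 1#
    invertible : ∀ x → ¬ x ≈ 0# → Invertible 1# _*_ x

record FiniteField c ℓ (q : ℕ) : Set (lsuc (c ⊔ ℓ)) where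
  field
    baseField : Field c ℓ
  open Field baseField public
  field
    order : HasCardinality setoid q

PrimePower : ℕ → Set
PrimePower q = ∃₂ λ p k → Prime p × 1 ℕ.≤ k × q ≡ p ℕ.^ k

module RationalFunctions {c ℓ q} (F : FiniteField c ℓ q) where
  open FiniteField F hiding (zero)
  open Polynomials commutativeRing public
  open Relation.Binary.Reasoning.Setoid setoid

  infix 4 _≟_
  _≟_ : ∀ x y → Dec (x ≈ y)
  x ≟ y = map′ (λ eq → trans (sym (inverseʳ ≡.refl)) (trans (from-cong eq) (inverseʳ ≡.refl)))
               to-cong
               (to x Fin.≟ to y)
    where open Inverse order

  -- The projective line: just a is a ∈ 𝔽, and nothing is ∞.
  ℙ¹ : DecSetoid c (c ⊔ ℓ)
  ℙ¹ = Maybe.decSetoid record { isDecEquivalence = record { isEquivalence = isEquivalence ; _≟_ = _≟_ } }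

  module ℙ¹ = DecSetoid ℙ¹

  pattern ∞ = nothing

  -- Division by zero is ∞, whatever the numerator; for coprime V and U the case
  -- 0 ÷ 0 does not occur in the definition of fraction below.
  infixl 7 _÷_
  _÷_ : Carrier → Carrier → ℙ¹.Carrier
  x ÷ y with y ≟ 0#
  ... | yes _  = ∞
  ... | no y≉0 = just (x * proj₁ (invertible y y≉0))

  -- A representation V/U in lowest terms with deg V = v and deg U = u; HasDegree
  -- makes both polynomials nonzero, and Coprime says every common divisor is a unit.
  record RationalFunction (v u : ℕ) : Set (c ⊔ ℓ) where
    field
      num den    : Poly
      num-degree : HasDegree num v
      den-degree : HasDegree den u
      coprime    : Coprime num den

  fraction : (v u : ℕ) (V U : Poly) → ℙ¹.Carrier → ℙ¹.Carrier
  fraction v u V U (just a) = eval V a ÷ eval U a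
  fraction v u V U ∞ with ℕ.<-cmp v u
  ... | tri< _ _ _ = just 0#
  ... | tri≈ _ _ _ = coeff V v ÷ coeff U u
  ... | tri> _ _ _ = ∞

  ⟦_⟧ : ∀ {v u} → RationalFunction v u → ℙ¹.Carrier → ℙ¹.Carrier
  ⟦_⟧ {v} {u} f = fraction v u (RationalFunction.num f) (RationalFunction.den f)

  IsPRF : ∀ {v u} → RationalFunction v u → Set (c ⊔ ℓ)
  IsPRF f = Bijective ℙ¹._≈_ ℙ¹._≈_ ⟦ f ⟧

  PRF : ℕ → ℕ → Set (c ⊔ ℓ)
  PRF v u = Σ (RationalFunction v u) IsPRF

  -- Equality in the field of fractions of 𝔽[X].
  _≈ᵣ_ : ∀ {v u} → PRF v u → PRF v u → Set ℓ
  (f , _) ≈ᵣ (g , _) = num f *ₚ den g ≈ₚ num g *ₚ den f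
    where open RationalFunction

  *-nonzero : ∀ {x y} → ¬ x ≈ 0# → ¬ y ≈ 0# → ¬ x * y ≈ 0#
  *-nonzero {x} {y} x≉0 y≉0 xy≈0 = y≉0 (begin
    y              ≈⟨ *-identityˡ y ⟨
    1# * y         ≈⟨ *-congʳ inv ⟨
    x⁻¹ * x * y    ≈⟨ *-assoc x⁻¹ x y ⟩
    x⁻¹ * (x * y)  ≈⟨ *-congˡ xy≈0 ⟩
    x⁻¹ * 0#       ≈⟨ zeroʳ x⁻¹ ⟩
    0#             ∎)
    where
    x⁻¹ = proj₁ (invertible x x≉0)
    inv = proj₁ (proj₂ (invertible x x≉0))

  *ₚ-degree : ∀ {p q m n} → HasDegree p m → HasDegree q n → HasDegree (p *ₚ q) (m ℕ.+ n)
  *ₚ-degree {p} {q} (p≉ , bp) (q≉ , bq) =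
    (λ eq → *-nonzero p≉ q≉ (trans (sym (*ₚ-leading p {q} bp bq)) eq)) , *ₚ-bounded p {q} bp bq

  zeroOrDegree : ∀ p → p ≈ₚ 0ₚ ⊎ ∃ (HasDegree p)
  zeroOrDegree [] = inj₁ ≈ₚ-refl
  zeroOrDegree (a ∷ p) with zeroOrDegree p
  ... | inj₂ (n , p≉ , bd) = inj₂ (suc n , p≉ , λ { (suc i) (s≤s lt) → bd i lt })
  ... | inj₁ p≈0 with a ≟ 0#
  ...   | yes a≈0 = inj₁ (≈ₚ-trans (∷-cong a≈0 p≈0) 0∷0)
  ...   | no a≉0  = inj₂ (0 , a≉0 , λ { (suc i) _ → coeff-≈ p≈0 i })

  degree⇒≉0 : ∀ {p n} → HasDegree p n → ¬ p ≈ₚ 0ₚ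
  degree⇒≉0 (p≉ , _) p≈0 = p≉ (coeff-≈ p≈0 _)

  private
    module PR = CommutativeRing polyRing
    open import Algebra.Properties.Ring PR.ring using (x[y-z]≈xy-xz; x∙y⁻¹≈ε⇒x≈y)

  *ₚ-cancelˡ : ∀ r {p q n} → HasDegree r n → r *ₚ p ≈ₚ r *ₚ q → p ≈ₚ q
  *ₚ-cancelˡ r {p} {q} r-deg eq with zeroOrDegree (p +ₚ -ₚ q)
  ... | inj₁ p-q≈0      = x∙y⁻¹≈ε⇒x≈y p q p-q≈0
  ... | inj₂ (m , p-q°) = ⊥-elim (degree⇒≉0 (*ₚ-degree {r} {p +ₚ -ₚ q} r-deg p-q°)
        (≈ₚ-trans (x[y-z]≈xy-xz r p q) (≈ₚ-trans (PR.+-congʳ eq) (PR.-‿inverseʳ (r *ₚ q)))))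

  ≈ᵣ-trans : ∀ {v u} {f g h : PRF v u} → f ≈ᵣ g → g ≈ᵣ h → f ≈ᵣ h
  ≈ᵣ-trans {f = f , _} {g , _} {h , _} eq₁ eq₂ = *ₚ-cancelˡ (den g) (den-degree g) (≈R.begin
    den g *ₚ (num f *ₚ den h)  ≈R.≈⟨ x∙yz≈yx∙z (den g) (num f) (den h) ⟩
    (num f *ₚ den g) *ₚ den h  ≈R.≈⟨ *ₚ-cong eq₁ ≈ₚ-refl ⟩
    (num g *ₚ den f) *ₚ den h  ≈R.≈⟨ xy∙z≈y∙xz (num g) (den f) (den h) ⟩
    den f *ₚ (num g *ₚ den h)  ≈R.≈⟨ *ₚ-congˡ (den f) eq₂ ⟩
    den f *ₚ (num h *ₚ den g)  ≈R.≈⟨ x∙yz≈z∙yx (den f) (num h) (den g) ⟩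
    den g *ₚ (num h *ₚ den f)  ≈R.∎)
    where
    open RationalFunction
    open import Algebra.Properties.CommutativeSemigroup (CommutativeRing.*-commutativeSemigroup polyRing)
    module ≈R = Relation.Binary.Reasoning.Setoid polySetoid

  infix 4 _≟ₚ_
  _≟ₚ_ : ∀ p q → Dec (p ≈ₚ q)
  p ≟ₚ q = map′ (λ eq → x∙y⁻¹≈ε⇒x≈y p q eq) (λ eq → PR.trans (PR.+-congʳ eq) (PR.-‿inverseʳ q)) (zero? (p +ₚ -ₚ q))
    where
    zero? : ∀ p → Dec (p ≈ₚ 0ₚ)
    zero? p with zeroOrDegree p
    ... | inj₁ p≈0      = yes p≈0
    ... | inj₂ (n , p°) = no (degree⇒≉0 {p} p°)

  hasDegree? : ∀ p n → Dec (HasDegree p n)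
  hasDegree? p n with zeroOrDegree p
  ... | inj₁ p≈0 = no λ p° → degree⇒≉0 {p} p° p≈0
  ... | inj₂ (m , p°) with m ℕ.≟ n
  ...   | yes ≡.refl = yes p°
  ...   | no m≢n     = no λ p°′ → m≢n (HasDegree-unique {p} p° p°′)

  PRFs : ℕ → ℕ → DecSetoid (c ⊔ ℓ) ℓ
  PRFs v u = record
    { Carrier = PRF v u
    ; _≈_     = _≈ᵣ_
    ; isDecEquivalence = record
      { isEquivalence = record
        { refl  = ≈ₚ-refl
        ; sym   = ≈ₚ-sym
        ; trans = λ {f} {g} {h} → ≈ᵣ-trans {f = f} {g} {h}
        }
      ; _≟_ = λ (f , _) (g , _) → num f *ₚ den g ≟ₚ num g *ₚ den f
      }
    }
    where open RationalFunction

  fieldEnumerable : Enumerable setoid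
  fieldEnumerable = finToEnumerable setoid order

  vectors : ℕ → Setoid c ℓ
  vectors = Vector.≋-setoid setoid

  vectorsEnumerable′ : ∀ n → Enumerable (vectors n)
  vectorsEnumerable′ = vectorsEnumerable setoid fieldEnumerable

  ∣ₚ-factors-bounded : ∀ {d p n} → HasDegree p n → ((k , _) : d ∣ₚ p) → Bounded k n × Bounded d n
  ∣ₚ-factors-bounded {d} {p} p° (k , kd≈p) with zeroOrDegree k | zeroOrDegree d
  ... | inj₁ k≈0 | _ = ⊥-elim (degree⇒≉0 {p} p° (≈ₚ-trans (≈ₚ-sym kd≈p) (*ₚ-cong k≈0 (≈ₚ-refl {d}))))
  ... | inj₂ _ | inj₁ d≈0 = ⊥-elim (degree⇒≉0 {p} p°
        (≈ₚ-trans (≈ₚ-sym kd≈p) (≈ₚ-trans (*ₚ-congˡ k d≈0) (*ₚ-zeroʳ k))))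
  ... | inj₂ (m , k°) | inj₂ (l , d°)
      with HasDegree-unique {p} (HasDegree-resp kd≈p (*ₚ-degree {k} {d} k° d°)) p°
  ...   | ≡.refl = (λ i lt → proj₂ k° i (ℕ.≤-<-trans (ℕ.m≤m+n m l) lt))
                 , (λ i lt → proj₂ d° i (ℕ.≤-<-trans (ℕ.m≤n+m l m) lt))

  divides? : ∀ {p n} → HasDegree p n → ∀ d → Dec (d ∣ₚ p)
  divides? {p} {n} p° d = map′
    (λ (f , eq) → fromVector f , eq)
    (λ { (k , eq) → coefficientVector (suc n) k
       , ≈ₚ-trans (*ₚ-cong {p′ = k} (≈ₚ-sym (≈fromVector (proj₁ (∣ₚ-factors-bounded {d} p° (k , eq))))) (≈ₚ-refl {d})) eq })
    (enumerable⇒any? (vectors (suc n)) (vectorsEnumerable′ (suc n))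
      (λ f≈g eq → ≈ₚ-trans (*ₚ-cong (fromVector-cong (λ i → sym (f≈g i))) (≈ₚ-refl {d})) eq)
      (λ f → fromVector f *ₚ d ≟ₚ p))

  ∣ₚ-respˡ : ∀ {d e p} → d ≈ₚ e → d ∣ₚ p → e ∣ₚ p
  ∣ₚ-respˡ d≈e (k , eq) = k , ≈ₚ-trans (*ₚ-congˡ k (≈ₚ-sym d≈e)) eq

  ∣ₚ-respʳ : ∀ {d p q} → p ≈ₚ q → d ∣ₚ p → d ∣ₚ q
  ∣ₚ-respʳ p≈q (k , eq) = k , ≈ₚ-trans eq p≈q

  Coprime-resp : ∀ {p p′ q q′} → p ≈ₚ p′ → q ≈ₚ q′ → Coprime p q → Coprime p′ q′
  Coprime-resp p≈ q≈ cop d∣p d∣q = cop (∣ₚ-respʳ (≈ₚ-sym p≈) d∣p) (∣ₚ-respʳ (≈ₚ-sym q≈) d∣q)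

  coprime? : ∀ {p q m n} → HasDegree p m → HasDegree q n → Dec (Coprime p q)
  coprime? {p} {q} {m} p° q° = map′
    (λ cop {d} d∣p d∣q →
      let d≈ = ≈fromVector (proj₂ (∣ₚ-factors-bounded {d} p° d∣p)) in
      ∣ₚ-respˡ (≈ₚ-sym d≈) (cop (coefficientVector (suc m) d) (∣ₚ-respˡ d≈ d∣p) (∣ₚ-respˡ d≈ d∣q)))
    (λ cop f → cop)
    (enumerable⇒all? (vectors (suc m)) (vectorsEnumerable′ (suc m))
      (λ f≈g cop d∣p d∣q → ∣ₚ-respˡ (fromVector-cong f≈g)
        (cop (∣ₚ-respˡ (fromVector-cong (λ i → sym (f≈g i))) d∣p) (∣ₚ-respˡ (fromVector-cong (λ i → sym (f≈g i))) d∣q)))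
      λ f → divides? {p} p° (fromVector f) →-dec (divides? {q} q° (fromVector f) →-dec divides? {1ₚ} 1-degree (fromVector f)))
    where
    1-degree : HasDegree 1ₚ 0
    1-degree = (λ eq → 0≉1 (sym eq)) , λ { (suc i) _ → refl }

  ÷-cong : ∀ {x x′ y y′} → x ≈ x′ → y ≈ y′ → x ÷ y ℙ¹.≈ x′ ÷ y′
  ÷-cong {x} {x′} {y} {y′} x≈ y≈ with y ≟ 0# | y′ ≟ 0#
  ... | yes _   | yes _    = nothing
  ... | yes y≈0 | no y′≉0  = contradiction (trans (sym y≈) y≈0) y′≉0
  ... | no y≉0  | yes y′≈0 = contradiction (trans y≈ y′≈0) y≉0
  ... | no y≉0  | no y′≉0 with invertible y y≉0 | invertible y′ y′≉0
  ...   | i , iy , _ | j , _ , y′j = just (*-cong x≈ (begin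
    i             ≈⟨ *-identityʳ i ⟨
    i * 1#        ≈⟨ *-congˡ y′j ⟨
    i * (y′ * j)  ≈⟨ *-assoc i y′ j ⟨
    i * y′ * j    ≈⟨ *-congʳ (*-congˡ y≈) ⟨
    i * y * j     ≈⟨ *-congʳ iy ⟩
    1# * j        ≈⟨ *-identityˡ j ⟩
    j             ∎))

  fraction-cong : ∀ v u {V V′ U U′} → V ≈ₚ V′ → U ≈ₚ U′ →
                  ∀ {x y} → x ℙ¹.≈ y → fraction v u V U x ℙ¹.≈ fraction v u V′ U′ y
  fraction-cong v u V≈ U≈ (just x≈y) = ÷-cong (eval-cong V≈ x≈y) (eval-cong U≈ x≈y)
  fraction-cong v u V≈ U≈ ∞ with ℕ.<-cmp v u
  ... | tri< _ _ _ = just refl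
  ... | tri≈ _ _ _ = ÷-cong (coeff-≈ V≈ v) (coeff-≈ U≈ u)
  ... | tri> _ _ _ = ∞

  ℙ¹-enumerable : Enumerable ℙ¹.setoid
  ℙ¹-enumerable with fieldEnumerable
  ... | xs , x∈xs = ∞ ∷ List.map just xs , λ
    { ∞        → here nothing
    ; (just x) → there (Membershipₚ.∈-map⁺ setoid ℙ¹.setoid just (x∈xs x))
    }

  bijective? : (f : ℙ¹.Carrier → ℙ¹.Carrier) → Congruent ℙ¹._≈_ ℙ¹._≈_ f → Dec (Bijective ℙ¹._≈_ ℙ¹._≈_ f)
  bijective? f f-cong =
    map′ (λ inj {x} {y} → inj x y) (λ inj x y → inj)
      (all? (λ x≈ inj y eq → ℙ¹.trans (ℙ¹.sym x≈) (inj y (ℙ¹.trans (f-cong x≈) eq)))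
        λ x → all? (λ y≈ inj eq → ℙ¹.trans (inj (ℙ¹.trans eq (f-cong (ℙ¹.sym y≈)))) y≈)
          λ y → (f x ℙ¹.≟ f y) →-dec (x ℙ¹.≟ y))
    ×-dec
    map′ (λ sur y → proj₁ (sur y) , λ z≈ → ℙ¹.trans (f-cong z≈) (proj₂ (sur y)))
         (λ sur y → proj₁ (sur y) , proj₂ (sur y) ℙ¹.refl)
      (all? (λ y≈ (x , eq) → x , ℙ¹.trans eq y≈)
        λ y → enumerable⇒any? ℙ¹.setoid ℙ¹-enumerable (λ x≈ eq → ℙ¹.trans (f-cong (ℙ¹.sym x≈)) eq)
          λ x → f x ℙ¹.≟ y)
    where
    all? : ∀ {p} {P : ℙ¹.Carrier → Set p} → (∀ {x y} → x ℙ¹.≈ y → P x → P y) →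
           (∀ x → Dec (P x)) → Dec (∀ x → P x)
    all? = enumerable⇒all? ℙ¹.setoid ℙ¹-enumerable

  Bijective-resp : ∀ {f g} → (∀ x → f x ℙ¹.≈ g x) →
                   Bijective ℙ¹._≈_ ℙ¹._≈_ f → Bijective ℙ¹._≈_ ℙ¹._≈_ g
  Bijective-resp f≈g (inj , sur) =
      (λ {x} {y} eq → inj (ℙ¹.trans (f≈g x) (ℙ¹.trans eq (ℙ¹.sym (f≈g y)))))
    , λ y → proj₁ (sur y) , λ {z} z≈ → ℙ¹.trans (ℙ¹.sym (f≈g z)) (proj₂ (sur y) z≈)

  PRFsEnumerable : ∀ v u → Enumerable (DecSetoid.setoid (PRFs v u))
  PRFsEnumerable v u = enumerablePart {S = vectors (suc v) ×ₛ vectors (suc u)} (DecSetoid.setoid (PRFs v u))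
      (let (xs , x∈) = vectorsEnumerable′ (suc v)
           (ys , y∈) = vectorsEnumerable′ (suc u)
       in cartesianProduct xs ys , Enum.cartesianProduct⁺ (vectors (suc v)) (vectors (suc u)) x∈ y∈)
      (λ (f , g) → isPRF? (fromVector f) (fromVector g))
      (λ (f , g) (V° , U° , cop , bij) → record
        { num = fromVector f ; den = fromVector g ; num-degree = V° ; den-degree = U° ; coprime = cop } , bij)
      complete
    where
    Is : Poly → Poly → Set (c ⊔ ℓ)
    Is V U = HasDegree V v × HasDegree U u × Coprime V U × Bijective ℙ¹._≈_ ℙ¹._≈_ (fraction v u V U)

    isPRF? : ∀ V U → Dec (Is V U)
    isPRF? V U with hasDegree? V v | hasDegree? U u
    ... | no ¬V° | _      = no λ (V° , _) → ¬V° V°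
    ... | yes _  | no ¬U° = no λ (_ , U° , _) → ¬U° U°
    ... | yes V° | yes U° = map′ (λ (cop , bij) → V° , U° , (λ {z} → cop {z}) , bij) (λ (_ , _ , cop , bij) → (λ {z} → cop {z}) , bij)
      (coprime? {V} {U} V° U° ×-dec
       bijective? (fraction v u V U) (fraction-cong v u (≈ₚ-refl {V}) (≈ₚ-refl {U})))

    complete : (f : PRF v u) → ∃ λ s → ∀ {s′} → Setoid._≈_ (vectors (suc v) ×ₛ vectors (suc u)) s s′ →
               Is (fromVector (proj₁ s′)) (fromVector (proj₂ s′)) ×
               (Is (fromVector (proj₁ s′)) (fromVector (proj₂ s′)) →
                 RationalFunction.num (proj₁ f) *ₚ fromVector (proj₂ s′) ≈ₚ
                 fromVector (proj₁ s′) *ₚ RationalFunction.den (proj₁ f))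
    complete (f , bij) = (coefficientVector (suc v) num , coefficientVector (suc u) den) , λ {(g , h)} (g≈ , h≈) →
      let V≈ = ≈ₚ-trans (≈fromVector (proj₂ num-degree)) (fromVector-cong {f = coefficientVector (suc v) num} {g} g≈)
          U≈ = ≈ₚ-trans (≈fromVector (proj₂ den-degree)) (fromVector-cong {f = coefficientVector (suc u) den} {h} h≈)
      in ( HasDegree-resp V≈ num-degree , HasDegree-resp U≈ den-degree
         , (λ {z} → Coprime-resp V≈ U≈ coprime {z})
         , Bijective-resp (λ x → fraction-cong v u V≈ U≈ (ℙ¹.refl {x})) bij)
       , λ _ → *ₚ-cong V≈ (≈ₚ-sym U≈)
      where open RationalFunction f

  PRFs-cardinality : ∀ v u → ∃ (HasCardinality (DecSetoid.setoid (PRFs v u)))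
  PRFs-cardinality v u = enumerable⇒cardinality (PRFs v u) (PRFsEnumerable v u)

  N : ℕ → ℕ → ℕ
  N v u = proj₁ (PRFs-cardinality v u)

  Admissible : ℕ → ℕ × ℕ → Set
  Admissible d (v , u) =
      (u ℕ.< v × v ℕ.≤ (d ℕ.+ 1) ℕ./ 2)
    ⊎ (v ℕ.< u × u ℕ.≤ (d ℕ.∸ 3) ℕ./ 2)
    ⊎ (v ≡ u   × v ℕ.≤ (d ℕ.∸ 3) ℕ./ 2)

  admissible? : ∀ d vu → Dec (Admissible d vu)
  admissible? d (v , u) =
    (u ℕ.<? v ×-dec v ℕ.≤? (d ℕ.+ 1) ℕ./ 2) ⊎-dec
    (v ℕ.<? u ×-dec u ℕ.≤? (d ℕ.∸ 3) ℕ./ 2) ⊎-dec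
    (v ℕ.≟ u ×-dec v ℕ.≤? (d ℕ.∸ 3) ℕ./ 2)

  -- For d ≥ 1 an admissible pair has both entries at most d, so the range cut-off
  -- drops nothing; for odd d ≥ 3 the divisions in Admissible are exact.
  𝓢 : ℕ → ℕ
  𝓢 d = ℕ.sum (List.map (λ (v , u) → N v u)
    (filter (admissible? d) (cartesianProduct (upTo (suc d)) (upTo (suc d)))))

{-# OPTIONS --safe #-}

module Submission where

-- Contracting a PRF φ at ∞ (the pole takes over the value φ(∞)) gives a permutation of 𝔽.
-- If the contractions of V/U ≠ R/S agree at x, then x is a root of VS − RU or a finite pole
-- of one of the two functions, so x is a root of (VS − RU)·(X − pole)·(X − pole), where
-- a factor is omitted if the pole is ∞.  Admissibility bounds the degree of this product:
-- deg V + e ≤ (d + 1)/2 and deg U + e ≤ (d − 1)/2, where e is the number of finite poles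
-- of V/U, which is 0 if deg V > deg U.  So two contractions agree in at most d places.
-- Functions with different degree pairs are different since fractions in lowest terms
-- have unique degrees.

open import Defs
open import Algebra.Bundles using (CommutativeRing)
open import Algebra.Definitions.RawMagma using (_,_)
import Algebra.Solver.Ring.NaturalCoefficients.Default
import Data.Fin.Base as Fin
open import Data.Fin.Base using (Fin)
import Data.Fin.Properties as Fin
open import Data.Fin.Permutation as Perm using (Permutation′; permutation; _⟨$⟩ʳ_)
open import Data.List.Base as List using (List; []; _∷_; length; filter; allFin; cartesianProduct; upTo)
import Data.List.Properties as List
open import Data.List.Membership.Propositional using (_∈_)
open import Data.List.Relation.Unary.All as All using (All; []; _∷_)
import Data.List.Relation.Unary.All.Properties as All
open import Data.List.Relation.Unary.AllPairs using ([]; _∷_)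
open import Data.List.Relation.Unary.Any using (here; there)
open import Data.List.Relation.Unary.Unique.Setoid using (Unique)
import Data.List.Relation.Unary.Unique.Setoid.Properties as Unique
import Data.List.Relation.Unary.Unique.Propositional.Properties as Uniqueₚ
open import Data.Maybe.Base using (just; fromMaybe)
open import Data.Maybe.Relation.Binary.Pointwise using (just; nothing)
open import Data.Nat.Base as ℕ using (ℕ; zero; suc; z≤n; s≤s)
import Data.Nat.DivMod as ℕ
import Data.Nat.Divisibility as ℕ
import Data.Nat.ListAction as ℕ
import Data.Nat.Properties as ℕ
open import Data.Product.Base using (∃; ∃₂; _×_; _,_; proj₁; proj₂)
open import Data.Sum.Base using (_⊎_; inj₁; inj₂)
open import Function.Base using (_∘_)
open import Function.Bundles using (Inverse)
open import Function.Properties.Bijection using (Bijection⇒Inverse)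
open import Relation.Binary.Definitions using (tri<; tri≈; tri>)
open import Relation.Binary.PropositionalEquality as ≡ using (_≡_; _≢_)
import Relation.Binary.Reasoning.Setoid
open import Relation.Nullary using (¬_; yes; no; contradiction)
open import Relation.Nullary.Decidable using (¬?)
open import Relation.Unary using (Pred; Decidable)

-- Filtered lists and the indexing of a disjoint union of finite families.

length-filter-¬? : ∀ {a p} {A : Set a} {P : Pred A p} (P? : Decidable P) (xs : List A) →
                   length (filter (¬? ∘ P?) xs) ℕ.+ length (filter P? xs) ≡ length xs
length-filter-¬? P? [] = ≡.refl
length-filter-¬? P? (x ∷ xs) with P? x
... | yes _ = ≡.trans (ℕ.+-suc _ _) (≡.cong suc (length-filter-¬? P? xs))
... | no _  = ≡.cong suc (length-filter-¬? P? xs)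

module _ {i t} {I : Set i} {T : I → Set t} (N : I → ℕ) (enum : ∀ k → Fin (N k) → T k) where

  -- Cuts the index range, whose length is a sum of sizes, into consecutive blocks, one for each
  -- `k`. This makes one family out of all degree pairs.
  select : ∀ ks → Fin (ℕ.sum (List.map N ks)) → ∃ T
  select (k ∷ ks) x with Fin.splitAt (N k) x
  ... | inj₁ y = k , enum k y
  ... | inj₂ y = select ks y

  select-∈ : ∀ ks x → proj₁ (select ks x) ∈ ks
  select-∈ (k ∷ ks) x with Fin.splitAt (N k) x
  ... | inj₁ y = here ≡.refl
  ... | inj₂ y = there (select-∈ ks y)

  -- Indices in different blocks are separated because related elements have equal keys and the keys
  -- in `ks` are distinct; within a block, `enum` separates them.
  select-injective : ∀ {r} {_~_ : ∃ T → ∃ T → Set r} →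
                     (∀ {a b} → a ~ b → proj₁ a ≡ proj₁ b) →
                     (∀ {k x y} → (k , enum k x) ~ (k , enum k y) → x ≡ y) →
                     ∀ {ks} → Unique (≡.setoid I) ks → ∀ x y → select ks x ~ select ks y → x ≡ y
  select-injective {_~_ = _~_} ~⇒≡ inj {k ∷ ks} (k∉ ∷ ks!) x y eq
    with Fin.splitAt (N k) x in x≡ | Fin.splitAt (N k) y in y≡
  ... | inj₁ a | inj₁ b = ≡.trans (≡.sym (Fin.splitAt⁻¹-↑ˡ x≡))
        (≡.trans (≡.cong (Fin._↑ˡ _) (inj eq)) (Fin.splitAt⁻¹-↑ˡ y≡))
  ... | inj₁ a | inj₂ b = contradiction (~⇒≡ eq) (All.lookup k∉ (select-∈ ks b))
  ... | inj₂ a | inj₁ b = contradiction (≡.sym (~⇒≡ eq)) (All.lookup k∉ (select-∈ ks a))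
  ... | inj₂ a | inj₂ b = ≡.trans (≡.sym (Fin.splitAt⁻¹-↑ʳ x≡))
        (≡.trans (≡.cong (N k Fin.↑ʳ_) (select-injective {_~_ = _~_} ~⇒≡ inj ks! a b eq)) (Fin.splitAt⁻¹-↑ʳ y≡))

module _ {c ℓ q} (F : FiniteField c ℓ q) where
  open FiniteField F hiding (zero)
  open RationalFunctions F

  private
    module P = CommutativeRing polyRing
    module PSolver = Algebra.Solver.Ring.NaturalCoefficients.Default P.commutativeSemiring
    module KSolver = Algebra.Solver.Ring.NaturalCoefficients.Default commutativeSemiring
    module ≈R = Relation.Binary.Reasoning.Setoid setoid
    module ≈ₚR = Relation.Binary.Reasoning.Setoid polySetoid
    open import Algebra.Properties.Ring P.ring using (x∙y⁻¹≈ε⇒x≈y)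

  -- Evaluation respects sums and products.

  eval-+ : ∀ p r x → eval (p +ₚ r) x ≈ eval p x + eval r x
  eval-+ []      r       x = sym (+-identityˡ _)
  eval-+ (a ∷ p) []      x = sym (+-identityʳ _)
  eval-+ (a ∷ p) (b ∷ r) x = trans (+-congˡ (*-congˡ (eval-+ p r x)))
    (solve 5 (λ a b x p r → ((a :+ b) :+ (x :* (p :+ r))) := ((a :+ (x :* p)) :+ (b :+ (x :* r))))
      refl a b x (eval p x) (eval r x))
    where open KSolver

  eval-· : ∀ a p x → eval (a · p) x ≈ a * eval p x
  eval-· a []      x = sym (zeroʳ a)
  eval-· a (b ∷ p) x = trans (+-congˡ (*-congˡ (eval-· a p x)))
    (solve 4 (λ a b x p → ((a :* b) :+ (x :* (a :* p))) := (a :* (b :+ (x :* p)))) refl a b x (eval p x))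
    where open KSolver

  eval-* : ∀ p r x → eval (p *ₚ r) x ≈ eval p x * eval r x
  eval-* []      r x = sym (zeroˡ _)
  eval-* (a ∷ p) r x = trans (eval-+ (a · r) (0# ∷ p *ₚ r) x)
    (trans (+-cong (eval-· a r x) (trans (+-identityˡ _) (*-congˡ (eval-* p r x))))
    (solve 4 (λ a r x p → ((a :* r) :+ (x :* (p :* r))) := ((a :+ (x :* p)) :* r))
      refl a (eval r x) x (eval p x)))
    where open KSolver

  -- Division with remainder, Bézout and degrees of fractions in lowest terms.

  -- If p = ks + r, then a + Xp = (Xk)s + (a + Xr). The new remainder a + Xr has degree at most `n`,
  -- and subtracting the multiple `b · s` removes its coefficient at `n`.
  divide : ∀ {s n} → HasDegree s n → ∀ p →
           ∃₂ λ k r → p ≈ₚ k *ₚ s +ₚ r × (∀ i → n ℕ.≤ i → coeff r i ≈ 0#)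
  divide s° [] = [] , [] , ≈ₚ-refl , λ _ _ → refl
  divide {s} {n} s°@(s≉0 , s>) (a ∷ p) with divide s° p
  ... | k , r , eq , r< = b ∷ k , (a ∷ r) +ₚ -ₚ (b · s) , eq′ , r′<
    where
    s⁻¹ = proj₁ (invertible (coeff s n) s≉0)
    b = coeff (a ∷ r) n * s⁻¹
    bs≈ : b * coeff s n ≈ coeff (a ∷ r) n
    bs≈ = trans (*-assoc _ _ _)
      (trans (*-congˡ (proj₁ (proj₂ (invertible (coeff s n) s≉0)))) (*-identityʳ _))
    eq′ : a ∷ p ≈ₚ (b ∷ k) *ₚ s +ₚ ((a ∷ r) +ₚ -ₚ (b · s))
    eq′ = ≈ₚ-trans (∷-cong (sym (+-identityˡ a)) eq)
      (≈ₚ-sym (≈ₚR.begin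
        (b · s +ₚ ks) +ₚ ((a ∷ r) +ₚ -ₚ (b · s))
          ≈ₚR.≈⟨ solve 4 (λ x y z w → ((x :+ y) :+ (z :+ w)) := ((x :+ w) :+ (y :+ z)))
                   ≈ₚ-refl (b · s) ks (a ∷ r) (-ₚ (b · s)) ⟩
        (b · s +ₚ -ₚ (b · s)) +ₚ (ks +ₚ (a ∷ r))
          ≈ₚR.≈⟨ P.+-congʳ (P.-‿inverseʳ (b · s)) ⟩
        ks +ₚ (a ∷ r) ≈ₚR.∎))
      where
      open PSolver
      ks = 0# ∷ k *ₚ s
    coeff-r′ : ∀ i → coeff ((a ∷ r) +ₚ -ₚ (b · s)) i ≈ coeff (a ∷ r) i + - (b * coeff s i)
    coeff-r′ i = trans (coeff-+ (a ∷ r) (-ₚ (b · s)) i)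
      (+-congˡ (trans (coeff-neg (b · s) i) (-‿cong (coeff-· b s i))))
    r′< : ∀ i → n ℕ.≤ i → coeff ((a ∷ r) +ₚ -ₚ (b · s)) i ≈ 0#
    r′< i n≤i with ℕ.m≤n⇒m<n∨m≡n n≤i
    ... | inj₂ ≡.refl = trans (coeff-r′ i) (trans (+-congˡ (-‿cong bs≈)) (-‿inverseʳ _))
    ... | inj₁ n<i@(s≤s n≤j) = trans (coeff-r′ i)
      (trans (+-cong (r< _ n≤j) (-‿cong (trans (*-congˡ (s> i n<i)) (zeroʳ b)))) (-‿inverseʳ 0#))

  -- Euclid's algorithm. The number `n` is a strict bound on the degree of the second polynomial and
  -- decreases with each division.
  bezout : ∀ n V U → (∀ i → n ℕ.≤ i → coeff U i ≈ 0#) → Coprime V U →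
           ∃₂ λ A B → A *ₚ V +ₚ B *ₚ U ≈ₚ 1ₚ
  bezout n V U U< cop with zeroOrDegree U
  -- If U = 0, then `V` is itself a common divisor, hence a unit.
  bezout n V U U< cop | inj₁ U≈0 with cop {V} (1ₚ , *ₚ-identityˡ V) (0ₚ , ≈ₚ-sym U≈0)
  ... | A , AV≈1 = A , 0ₚ , ≈ₚ-trans (+ₚ-identityʳ (A *ₚ V)) AV≈1
  bezout zero V U U< cop | inj₂ (m , U≉ , _) = contradiction (U< m z≤n) U≉
  bezout (suc n) V U U< cop | inj₂ (m , U°) with divide {U} U° V
  ... | k , R , V≈kU+R , R<
      with bezout n U R
        -- The degree `m` of `U` is at most `n`, and the remainder vanishes from `m` on.
        (λ i n≤i → R< i (ℕ.≤-trans (ℕ.≤-pred (ℕ.≰⇒> λ n<m → proj₁ U° (U< m n<m))) n≤i))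
        (λ {z} (e , ez≈U) (f , fz≈R) →
          cop {z} (k *ₚ e +ₚ f , z∣V {z} {e} {f} ez≈U fz≈R) (e , ez≈U))
    where
    open PSolver
    z∣V : ∀ {z e f} → e *ₚ z ≈ₚ U → f *ₚ z ≈ₚ R → (k *ₚ e +ₚ f) *ₚ z ≈ₚ V
    z∣V {z} {e} {f} ez≈U fz≈R = ≈ₚR.begin
      (k *ₚ e +ₚ f) *ₚ z
        ≈ₚR.≈⟨ solve 4 (λ k e f z → ((k :* e :+ f) :* z) := (k :* (e :* z) :+ f :* z)) ≈ₚ-refl k e f z ⟩
      k *ₚ (e *ₚ z) +ₚ f *ₚ z
        ≈ₚR.≈⟨ +ₚ-cong (*ₚ-congˡ k ez≈U) fz≈R ⟩
      k *ₚ U +ₚ R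
        ≈ₚR.≈⟨ V≈kU+R ⟨
      V ≈ₚR.∎
  -- Substitute R = V - kU into AU + BR = 1.
  ...   | A , B , AU+BR≈1 = B , A +ₚ -ₚ (B *ₚ k) , (≈ₚR.begin
    B *ₚ V +ₚ (A +ₚ -ₚ (B *ₚ k)) *ₚ U
      ≈ₚR.≈⟨ P.+-congʳ (*ₚ-congˡ B V≈kU+R) ⟩
    B *ₚ (k *ₚ U +ₚ R) +ₚ (A +ₚ -ₚ (B *ₚ k)) *ₚ U
      -- The solver works in semirings, so the negated product enters as an independent variable
      -- `N`.
      ≈ₚR.≈⟨ solve 6 (λ A B k U R N → (B :* (k :* U :+ R) :+ (A :+ N) :* U) :=
               ((A :* U :+ B :* R) :+ (B :* k :+ N) :* U)) ≈ₚ-refl A B k U R (-ₚ (B *ₚ k)) ⟩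
    (A *ₚ U +ₚ B *ₚ R) +ₚ (B *ₚ k +ₚ -ₚ (B *ₚ k)) *ₚ U
      ≈ₚR.≈⟨ P.+-congˡ {A *ₚ U +ₚ B *ₚ R} (*ₚ-cong (P.-‿inverseʳ (B *ₚ k)) (≈ₚ-refl {U})) ⟩
    (A *ₚ U +ₚ B *ₚ R) +ₚ 0ₚ
      ≈ₚR.≈⟨ +ₚ-identityʳ (A *ₚ U +ₚ B *ₚ R) ⟩
    A *ₚ U +ₚ B *ₚ R
      ≈ₚR.≈⟨ AU+BR≈1 ⟩
    1ₚ ≈ₚR.∎)
    where open PSolver

  -- Multiply AV + BU = 1 by `R` and replace RU by VS: every term is then a multiple of `V`.
  coprime∧∣⇒∣ : ∀ {V U R S n} → HasDegree U n → Coprime V U → V *ₚ S ≈ₚ R *ₚ U → V ∣ₚ R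
  coprime∧∣⇒∣ {V} {U} {R} {S} {n} U° cop eq with bezout (suc n) V U (proj₂ U°) cop
  ... | A , B , AV+BU≈1 = R *ₚ A +ₚ B *ₚ S , (≈ₚR.begin
    (R *ₚ A +ₚ B *ₚ S) *ₚ V
      ≈ₚR.≈⟨ solve 5 (λ A B R S V → ((R :* A :+ B :* S) :* V) := (R :* (A :* V) :+ B :* (V :* S)))
               ≈ₚ-refl A B R S V ⟩
    R *ₚ (A *ₚ V) +ₚ B *ₚ (V *ₚ S)
      ≈ₚR.≈⟨ P.+-congˡ {R *ₚ (A *ₚ V)} (*ₚ-congˡ B eq) ⟩
    R *ₚ (A *ₚ V) +ₚ B *ₚ (R *ₚ U)
      ≈ₚR.≈⟨ solve 5 (λ A B R U V → (R :* (A :* V) :+ B :* (R :* U)) := (R :* (A :* V :+ B :* U)))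
               ≈ₚ-refl A B R U V ⟩
    R *ₚ (A *ₚ V +ₚ B *ₚ U)
      ≈ₚR.≈⟨ *ₚ-congˡ R AV+BU≈1 ⟩
    R *ₚ 1ₚ
      ≈ₚR.≈⟨ P.*-identityʳ R ⟩
    R ≈ₚR.∎)
    where open PSolver

  degree≤bound : ∀ {p m n} → HasDegree p m → Bounded p n → m ℕ.≤ n
  degree≤bound (p≉ , _) bd = ℕ.≮⇒≥ λ n<m → p≉ (bd _ n<m)

  ∣ₚ⇒degree≤ : ∀ {d p m n} → HasDegree d m → HasDegree p n → d ∣ₚ p → m ℕ.≤ n
  ∣ₚ⇒degree≤ {d} {p} d° p° d∣p = degree≤bound {d} d° (proj₂ (∣ₚ-factors-bounded {d} p° d∣p))

  infix 4 _≍_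
  -- Extends `_≈ᵣ_` to functions whose degree pairs may differ.
  _≍_ : ∀ {v u v′ u′} → PRF v u → PRF v′ u′ → Set ℓ
  (f , _) ≍ (g , _) = num f *ₚ den g ≈ₚ num g *ₚ den f
    where open RationalFunction

  -- By coprimality the two numerators divide each other, so their degrees agree. Comparing the
  -- degrees of the two cross products then gives the denominators.
  ≍⇒degrees≡ : ∀ {v u v′ u′} (f : PRF v u) (g : PRF v′ u′) → f ≍ g → _≡_ {A = ℕ × ℕ} (v , u) (v′ , u′)
  ≍⇒degrees≡ {v} {u} {v′} {u′} (f , _) (g , _) eq = ≡.cong₂ _,_ v≡v′ u≡u′
    where
    open RationalFunction
    v≡v′ : v ≡ v′
    v≡v′ = ℕ.≤-antisym
      (∣ₚ⇒degree≤ {num f} {num g} (num-degree f) (num-degree g)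
        (coprime∧∣⇒∣ {num f} {den f} {num g} {den g} (den-degree f) (λ {z} → coprime f {z}) eq))
      (∣ₚ⇒degree≤ {num g} {num f} (num-degree g) (num-degree f)
        (coprime∧∣⇒∣ {num g} {den g} {num f} {den f} (den-degree g) (λ {z} → coprime g {z}) (≈ₚ-sym eq)))
    u≡u′ : u ≡ u′
    u≡u′ = ℕ.+-cancelˡ-≡ v u u′ (≡.sym (≡.trans
      (HasDegree-unique {num f *ₚ den g} (*ₚ-degree {num f} {den g} (num-degree f) (den-degree g))
        (HasDegree-resp (≈ₚ-sym eq) (*ₚ-degree {num g} {den f} (num-degree g) (den-degree f))))
      (≡.cong (ℕ._+ u) (≡.sym v≡v′))))

  -- Linear factors and the number of roots.

  X-_ : Carrier → Poly
  X- a = - a ∷ 1# ∷ []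

  X-a-degree : ∀ a → HasDegree (X- a) 1
  X-a-degree a = (λ eq → 0≉1 (sym eq)) , λ { (suc (suc i)) _ → refl ; (suc zero) (s≤s ()) }

  eval-X-a : ∀ a x → eval (X- a) x ≈ x + - a
  eval-X-a a x = trans (+-comm _ _) (+-congʳ
    (trans (*-congˡ (trans (+-congˡ (zeroʳ x)) (+-identityʳ 1#))) (*-identityʳ x)))

  X-a-root : ∀ {a x} → a ≈ x → eval (X- a) x ≈ 0#
  X-a-root {a} {x} a≈x = trans (eval-X-a a x) (trans (+-congˡ (-‿cong a≈x)) (-‿inverseʳ x))

  X-a-nonroot : ∀ {a x} → ¬ a ≈ x → ¬ eval (X- a) x ≈ 0#
  X-a-nonroot {a} {x} a≉x eq = a≉x (sym (K.x∙y⁻¹≈ε⇒x≈y x a (trans (sym (eval-X-a a x)) eq)))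
    where import Algebra.Properties.Ring ring as K

  -- The remainder modulo X - a is a constant, and its value at `a` is p(a) = 0.
  factor : ∀ {p a} → eval p a ≈ 0# → ∃ λ k → p ≈ₚ k *ₚ X- a
  factor {p} {a} pa≈0 with divide {X- a} (X-a-degree a) p
  ... | k , r , eq , r< = k , ≈ₚ-trans eq
        (≈ₚ-trans (P.+-congˡ {k *ₚ X- a} r≈0) (+ₚ-identityʳ (k *ₚ X- a)))
    where
    ra≈0 : eval r a ≈ 0#
    ra≈0 = ≈R.begin
      eval r a                              ≈R.≈⟨ +-identityˡ _ ⟨
      0# + eval r a                         ≈R.≈⟨ +-congʳ (trans (*-congˡ (X-a-root refl)) (zeroʳ _)) ⟨
      eval k a * eval (X- a) a + eval r a   ≈R.≈⟨ +-congʳ (eval-* k (X- a) a) ⟨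
      eval (k *ₚ X- a) a + eval r a         ≈R.≈⟨ eval-+ (k *ₚ X- a) r a ⟨
      eval (k *ₚ X- a +ₚ r) a               ≈R.≈⟨ eval-cong eq refl ⟨
      eval p a                              ≈R.≈⟨ pa≈0 ⟩
      0#                                    ≈R.∎
    constant : r ≈ₚ coeff r 0 ∷ []
    constant = coeffs λ { zero → refl ; (suc i) → r< (suc i) (s≤s z≤n) }
    r≈0 : r ≈ₚ 0ₚ
    r≈0 = ≈ₚ-trans constant (≈ₚ-trans (∷-cong (≈R.begin
      coeff r 0             ≈R.≈⟨ +-identityʳ _ ⟨
      coeff r 0 + 0#        ≈R.≈⟨ +-congˡ (zeroʳ a) ⟨
      coeff r 0 + a * 0#    ≈R.≈⟨ eval-cong constant refl ⟨
      eval r a              ≈R.≈⟨ ra≈0 ⟩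
      0#                    ≈R.∎) ≈ₚ-refl) 0∷0)

  -- Splitting off X - x lowers the degree by one. The other listed roots differ from `x`, so they
  -- are roots of the cofactor.
  roots≤degree : ∀ {p n} → HasDegree p n → ∀ {xs} → Unique setoid xs →
                 All (λ x → eval p x ≈ 0#) xs → length xs ℕ.≤ n
  roots≤degree p° [] [] = z≤n
  roots≤degree {p} {n} p° {x ∷ xs} (x∉ ∷ xs!) (px≈0 ∷ roots) with factor {p} px≈0
  ... | k , eq with zeroOrDegree k
  ...   | inj₁ k≈0 = contradiction (≈ₚ-trans eq (*ₚ-cong k≈0 (≈ₚ-refl {X- x}))) (degree⇒≉0 {p} p°)
  ...   | inj₂ (m , k°) = ℕ.≤-trans (s≤s (roots≤degree {k} k° xs! (All.zipWith kroot (x∉ , roots))))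
          (ℕ.≤-reflexive (≡.trans (ℕ.+-comm 1 m)
            (HasDegree-unique {p} (HasDegree-resp (≈ₚ-sym eq) (*ₚ-degree {k} {X- x} k° (X-a-degree x))) p°)))
    where
    kroot : ∀ {y} → ¬ x ≈ y × eval p y ≈ 0# → eval k y ≈ 0#
    kroot {y} (x≉y , py≈0) with eval k y ≟ 0#
    ... | yes ky≈0 = ky≈0
    ... | no  ky≉0 = contradiction
          (trans (sym (eval-* k (X- x) y)) (trans (sym (eval-cong eq refl)) py≈0))
          (*-nonzero ky≉0 (X-a-nonroot x≉y))

  -- Contraction of bijections of the projective line.

  -- The default x is never used when φ is injective: φ x and φ ∞ cannot both be ∞.
  contract : (ℙ¹.Carrier → ℙ¹.Carrier) → Carrier → Carrier
  contract φ x = fromMaybe (fromMaybe x (φ ∞)) (φ (just x))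

  fromMaybe-just : ∀ {m x y} → m ℙ¹.≈ just y → fromMaybe x m ≈ y
  fromMaybe-just (just eq) = eq

  fromMaybe-∞ : ∀ {m x} → m ℙ¹.≈ ∞ → fromMaybe x m ≡ x
  fromMaybe-∞ nothing = ≡.refl

  fromMaybe-cong : ∀ {m n x y} → x ≈ y → m ℙ¹.≈ n → fromMaybe x m ≈ fromMaybe y n
  fromMaybe-cong _   (just eq) = eq
  fromMaybe-cong x≈y nothing   = x≈y

  contract-cong : ∀ {φ} → (∀ {x y} → x ℙ¹.≈ y → φ x ℙ¹.≈ φ y) →
                  ∀ {x y} → x ≈ y → contract φ x ≈ contract φ y
  contract-cong φ-cong x≈y = fromMaybe-cong (fromMaybe-cong x≈y (φ-cong ∞)) (φ-cong (just x≈y))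

  -- The case to check is ψ(y) = ∞, so φ(∞) = y. Then `contract ψ` sends y to b = ψ(∞); as φ(b) = ∞,
  -- `contract φ` sends b to φ(∞) = y.
  contract-inverse : ∀ {φ ψ} → (∀ y → φ (ψ y) ℙ¹.≈ y) → ∀ y → contract φ (contract ψ y) ≈ y
  contract-inverse {φ} {ψ} φψ y with ψ (just y) | φψ (just y) | ψ ∞ | φψ ∞
  ... | just x | φx≈y | _      | _     = fromMaybe-just φx≈y
  ... | ∞      | φ∞≈y | just b | φb≈∞  =
        trans (reflexive (fromMaybe-∞ φb≈∞)) (fromMaybe-just φ∞≈y)
  -- Here φ(∞) would be both ∞ and the finite value y.
  ... | ∞      | φ∞≈y | ∞      | φ∞≈∞  with ℙ¹.trans (ℙ¹.sym φ∞≈y) φ∞≈∞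
  ...   | ()

  private module Order = Inverse order

  contraction : Inverse ℙ¹.setoid ℙ¹.setoid → Permutation′ q
  contraction φ = permutation (Order.to ∘ contract Φ.to ∘ Order.from) (Order.to ∘ contract Φ.from ∘ Order.from)
    (inverse {Φ.to} {Φ.from} Φ.to-cong λ _ → Φ.inverseˡ ℙ¹.refl)
    (inverse {Φ.from} {Φ.to} Φ.from-cong λ _ → Φ.inverseʳ ℙ¹.refl)
    where
    module Φ = Inverse φ
    inverse : ∀ {φ ψ} → (∀ {x y} → x ℙ¹.≈ y → φ x ℙ¹.≈ φ y) → (∀ y → φ (ψ y) ℙ¹.≈ y) → ∀ i →
              Order.to (contract φ (Order.from (Order.to (contract ψ (Order.from i))))) ≡ i
    inverse {φ} {ψ} φ-cong φψ i = ≡.trans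
      (Order.to-cong (trans (contract-cong {φ} φ-cong (Order.inverseʳ ≡.refl))
                            (contract-inverse {φ} {ψ} φψ (Order.from i))))
      (Order.inverseˡ refl)

  -- Poles and the degree bounds from admissibility.

  poleFactor : ℙ¹.Carrier → Poly
  poleFactor (just a) = X- a
  poleFactor ∞        = 1ₚ

  poleCount : ℙ¹.Carrier → ℕ
  poleCount (just a) = 1
  poleCount ∞        = 0

  poleFactor-degree : ∀ m → HasDegree (poleFactor m) (poleCount m)
  poleFactor-degree (just a) = X-a-degree a
  poleFactor-degree ∞        = (λ eq → 0≉1 (sym eq)) , λ { (suc i) _ → refl }

  poleFactor-root : ∀ {m x} → m ℙ¹.≈ just x → eval (poleFactor m) x ≈ 0#
  poleFactor-root (just a≈x) = X-a-root a≈x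

  -- If φ(x) were ∞, then x would be the pole and hence a root of its factor.
  contract-finite : (φ : Inverse ℙ¹.setoid ℙ¹.setoid) → ∀ x → ¬ eval (poleFactor (Inverse.from φ ∞)) x ≈ 0# →
                    Inverse.to φ (just x) ℙ¹.≈ just (contract (Inverse.to φ) x)
  contract-finite φ x nonroot with Inverse.to φ (just x) in eq
  ... | just y = ℙ¹.refl
  ... | ∞      = contradiction
        (poleFactor-root (Inverse.inverseʳ φ (ℙ¹.reflexive (≡.sym eq)))) nonroot

  ÷≈just : ∀ {x y z} → x ÷ y ℙ¹.≈ just z → x ≈ z * y
  ÷≈just {x} {y} {z} eq with y ≟ 0#
  ÷≈just {x} {y} {z} (just eq) | no y≉0 with invertible y y≉0
  ... | y⁻¹ , left , _ = sym (trans (*-congʳ (sym eq))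
        (trans (*-assoc x y⁻¹ y) (trans (*-congˡ left) (*-identityʳ x))))

  toInverse : ∀ {v u} → PRF v u → Inverse ℙ¹.setoid ℙ¹.setoid
  toInverse {v} {u} (f , bijective) = Bijection⇒Inverse record
    { to        = ⟦ f ⟧
    ; cong      = fraction-cong v u (≈ₚ-refl {num}) (≈ₚ-refl {den})
    ; bijective = bijective
    }
    where open RationalFunction f

  pole : ∀ {v u} → PRF v u → ℙ¹.Carrier
  pole f = Inverse.from (toInverse f) ∞

  fraction-∞ : ∀ {v u} V U → u ℕ.< v → fraction v u V U ∞ ≡ ∞
  fraction-∞ {v} {u} V U u<v with ℕ.<-cmp v u
  ... | tri< _ _ u≮v = contradiction u<v u≮v
  ... | tri≈ _ _ u≮v = contradiction u<v u≮v
  ... | tri> _ _ _   = ≡.refl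

  poleCount-∞ : ∀ {m} → m ℙ¹.≈ ∞ → poleCount m ≡ 0
  poleCount-∞ nothing = ≡.refl

  pole-∞ : ∀ {v u} (f : PRF v u) → u ℕ.< v → pole f ℙ¹.≈ ∞
  pole-∞ f@(g , _) u<v = Inverse.inverseʳ (toInverse f) {∞} {∞}
    (ℙ¹.reflexive (≡.sym (fraction-∞ (num g) (den g) u<v)))
    where open RationalFunction

  poleCount≤1 : ∀ m → poleCount m ℕ.≤ 1
  poleCount≤1 (just _) = s≤s z≤n
  poleCount≤1 ∞        = z≤n

  -- If v > u, the pole is ∞ and adds nothing, while u < v ≤ A. Otherwise both degrees are at most
  -- (d - 3)/2 = A - 2, so one finite pole still leaves both sums strictly below A.
  admissible-bounds : ∀ {d v u} → 3 ℕ.≤ d → Admissible d (v , u) → (f : PRF v u) →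
                      let A = (d ℕ.+ 1) ℕ./ 2 in
                      v ℕ.+ poleCount (pole f) ℕ.≤ A × u ℕ.+ poleCount (pole f) ℕ.< A
  admissible-bounds {d} {v} {u} 3≤d adm f = bounds adm
    where
    e = poleCount (pole f)
    -- Write d + 1 = (d - 3) + 4; the truncated subtraction is exact since d ≥ 3.
    half : 2 ℕ.+ (d ℕ.∸ 3) ℕ./ 2 ≡ (d ℕ.+ 1) ℕ./ 2
    half = ≡.sym (≡.trans
      (≡.cong (λ n → (n ℕ.+ 1) ℕ./ 2) (≡.sym (ℕ.m∸n+n≡m 3≤d)))
      (≡.trans (≡.cong (ℕ._/ 2) (ℕ.+-assoc (d ℕ.∸ 3) 3 1))
      (≡.trans (ℕ.+-distrib-/-∣ʳ (d ℕ.∸ 3) {4} (ℕ.divides 2 ≡.refl)) (ℕ.+-comm ((d ℕ.∸ 3) ℕ./ 2) 2))))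
    small : ∀ {w} → w ℕ.≤ (d ℕ.∸ 3) ℕ./ 2 → w ℕ.+ e ℕ.< (d ℕ.+ 1) ℕ./ 2
    small {w} w≤ = ℕ.≤-trans (s≤s (ℕ.≤-trans (ℕ.+-mono-≤ w≤ (poleCount≤1 (pole f)))
      (ℕ.≤-reflexive (ℕ.+-comm _ 1)))) (ℕ.≤-reflexive half)
    bounds : Admissible d (v , u) → v ℕ.+ e ℕ.≤ (d ℕ.+ 1) ℕ./ 2 × u ℕ.+ e ℕ.< (d ℕ.+ 1) ℕ./ 2
    bounds (inj₁ (u<v , v≤)) rewrite poleCount-∞ (pole-∞ f u<v) | ℕ.+-identityʳ v | ℕ.+-identityʳ u =
      v≤ , ℕ.<-≤-trans u<v v≤
    bounds (inj₂ (inj₁ (v<u , u≤))) = ℕ.<⇒≤ (small (ℕ.≤-trans (ℕ.<⇒≤ v<u) u≤)) , small u≤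
    bounds (inj₂ (inj₂ (≡.refl , v≤))) = ℕ.<⇒≤ (small v≤) , small v≤

  -- Agreements of two contractions as roots of one polynomial.

  module _ {v u v′ u′} (f : PRF v u) (g : PRF v′ u′) where
    private
      open RationalFunction
      V = num (proj₁ f)
      U = den (proj₁ f)
      R = num (proj₁ g)
      S = den (proj₁ g)
      e = poleCount (pole f)
      e′ = poleCount (pole g)

      W = V *ₚ S +ₚ -ₚ (R *ₚ U)
      Q = poleFactor (pole f) *ₚ poleFactor (pole g)

    agreementPolynomial : Poly
    agreementPolynomial = W *ₚ Q

    -- `W` is nonzero as the functions differ. Its degree is bounded by that of one cross product,
    -- which pairs a numerator with the other function's denominator; each of the two degrees
    -- absorbs its own function's pole count.
    agreementPolynomial-degree : ∀ {d} → 3 ℕ.≤ d → Admissible d (v , u) → Admissible d (v′ , u′) →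
                                 ¬ f ≍ g → ∃ λ n → HasDegree agreementPolynomial n × n ℕ.≤ d
    agreementPolynomial-degree {d} 3≤d adm adm′ f≭g with zeroOrDegree W
    ... | inj₁ W≈0 = contradiction (x∙y⁻¹≈ε⇒x≈y (V *ₚ S) (R *ₚ U) W≈0) f≭g
    ... | inj₂ (w , W°@(W≉0 , _)) = w ℕ.+ (e ℕ.+ e′)
          , *ₚ-degree {W} {Q} W° (*ₚ-degree {poleFactor (pole f)} {poleFactor (pole g)}
              (poleFactor-degree (pole f)) (poleFactor-degree (pole g)))
          , ℕ.≤-pred (bound w-bound)
      where
      A = (d ℕ.+ 1) ℕ./ 2
      bounds = admissible-bounds 3≤d adm f
      bounds′ = admissible-bounds 3≤d adm′ g
      2A≤1+d : A ℕ.+ A ℕ.≤ suc d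
      2A≤1+d = ℕ.≤-trans (ℕ.≤-reflexive (≡.trans (≡.cong (A ℕ.+_) (≡.sym (ℕ.+-identityʳ A)))
                                               (ℕ.*-comm 2 A)))
        (ℕ.≤-trans (ℕ.m/n*n≤m (d ℕ.+ 1) 2) (ℕ.≤-reflexive (ℕ.+-comm d 1)))
      w-bound : w ℕ.≤ v ℕ.+ u′ ⊎ w ℕ.≤ v′ ℕ.+ u
      w-bound with w ℕ.≤? v ℕ.+ u′ | w ℕ.≤? v′ ℕ.+ u
      ... | yes w≤ | _      = inj₁ w≤
      ... | no _   | yes w≤ = inj₂ w≤
      -- Beyond both product degrees every coefficient of `W` is zero, contrary to the choice of
      -- `w`.
      ... | no w≰  | no w≰′ = contradiction
            (trans (coeff-+ (V *ₚ S) (-ₚ (R *ₚ U)) w) (trans (+-cong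
              (*ₚ-bounded V {S} (proj₂ (num-degree (proj₁ f))) (proj₂ (den-degree (proj₁ g)))
                w (ℕ.≰⇒> w≰))
              (trans (coeff-neg (R *ₚ U) w) (-‿cong
                (*ₚ-bounded R {U} (proj₂ (num-degree (proj₁ g))) (proj₂ (den-degree (proj₁ f)))
                  w (ℕ.≰⇒> w≰′)))))
              (-‿inverseʳ 0#)))
            W≉0
      -- The strict bound on the denominator side supplies the successor: the total is less than 2A
      -- ≤ d + 1, hence at most d.
      regroup : ∀ {a b x y} → w ℕ.≤ a ℕ.+ b → a ℕ.+ x ℕ.≤ A → b ℕ.+ y ℕ.< A →
                suc (w ℕ.+ (x ℕ.+ y)) ℕ.≤ suc d
      regroup {a} {b} {x} {y} w≤ a≤ b< = begin
        suc (w ℕ.+ (x ℕ.+ y))                ≤⟨ s≤s (ℕ.+-monoˡ-≤ (x ℕ.+ y) w≤) ⟩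
        suc ((a ℕ.+ b) ℕ.+ (x ℕ.+ y))        ≡⟨ ≡.cong suc (interchange a b x y) ⟩
        suc ((a ℕ.+ x) ℕ.+ (b ℕ.+ y))        ≡⟨ ℕ.+-suc (a ℕ.+ x) (b ℕ.+ y) ⟨
        (a ℕ.+ x) ℕ.+ suc (b ℕ.+ y)          ≤⟨ ℕ.+-mono-≤ a≤ b< ⟩
        A ℕ.+ A                              ≤⟨ 2A≤1+d ⟩
        suc d                                ∎
        where
        open ℕ.≤-Reasoning
        open import Algebra.Properties.CommutativeSemigroup ℕ.+-commutativeSemigroup using (interchange)
      bound : w ℕ.≤ v ℕ.+ u′ ⊎ w ℕ.≤ v′ ℕ.+ u → suc (w ℕ.+ (e ℕ.+ e′)) ℕ.≤ suc d
      bound (inj₁ w≤) = regroup {v} w≤ (proj₁ bounds) (proj₂ bounds′)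
      bound (inj₂ w≤) = ≡.subst (λ n → suc (w ℕ.+ n) ℕ.≤ suc d) (ℕ.+-comm e′ e)
        (regroup {v′} w≤ (proj₁ bounds′) (proj₂ bounds))

    eval-W : ∀ {x} → eval V x * eval S x ≈ eval R x * eval U x → eval W x ≈ 0#
    eval-W {x} eq = ≈R.begin
      eval W x                                   ≈R.≈⟨ eval-+ (V *ₚ S) (-ₚ (R *ₚ U)) x ⟩
      eval (V *ₚ S) x + eval (-ₚ (R *ₚ U)) x     ≈R.≈⟨ +-congʳ (trans (eval-* V S x)
                                                        (trans eq (sym (eval-* R U x)))) ⟩
      eval (R *ₚ U) x + eval (-ₚ (R *ₚ U)) x     ≈R.≈⟨ eval-+ (R *ₚ U) (-ₚ (R *ₚ U)) x ⟨
      eval (R *ₚ U +ₚ -ₚ (R *ₚ U)) x             ≈R.≈⟨ eval-zero (R *ₚ U +ₚ -ₚ (R *ₚ U)) x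
                                                        (P.-‿inverseʳ (R *ₚ U)) ⟩
      0#                                         ≈R.∎

    -- At a finite pole `Q` vanishes. Elsewhere both contractions are the true values of V/U and
    -- R/S, and clearing denominators gives VS = RU at `x`.
    agreement⇒root : ∀ x → contract ⟦ proj₁ f ⟧ x ≈ contract ⟦ proj₁ g ⟧ x →
                     eval agreementPolynomial x ≈ 0#
    agreement⇒root x agree = trans (eval-* W Q x) vanishes
      where
      eval-Q : eval Q x ≈ eval (poleFactor (pole f)) x * eval (poleFactor (pole g)) x
      eval-Q = eval-* (poleFactor (pole f)) (poleFactor (pole g)) x
      vanishes : eval W x * eval Q x ≈ 0#
      vanishes with eval (poleFactor (pole f)) x ≟ 0# | eval (poleFactor (pole g)) x ≟ 0#
      ... | yes Pf≈0 | _        = trans (*-congˡ (trans eval-Q (trans (*-congʳ Pf≈0) (zeroˡ _)))) (zeroʳ _)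
      ... | no _     | yes Pg≈0 = trans (*-congˡ (trans eval-Q (trans (*-congˡ Pg≈0) (zeroʳ _)))) (zeroʳ _)
      ... | no Pf≉0  | no Pg≉0  = trans (*-congʳ (eval-W (≈R.begin
        eval V x * eval S x              ≈R.≈⟨ *-congʳ (÷≈just (contract-finite (toInverse f) x Pf≉0)) ⟩
        y * eval U x * eval S x          ≈R.≈⟨ solve 3 (λ y u s → ((y :* u) :* s) := ((y :* s) :* u))
                                                  refl y (eval U x) (eval S x) ⟩
        y * eval S x * eval U x          ≈R.≈⟨ *-congʳ (*-congʳ agree) ⟩
        z * eval S x * eval U x          ≈R.≈⟨ *-congʳ (÷≈just (contract-finite (toInverse g) x Pg≉0)) ⟨
        eval R x * eval U x              ≈R.∎))) (zeroˡ _)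
        where
        open KSolver using (solve; _:*_; _:=_)
        y = contract ⟦ proj₁ f ⟧ x
        z = contract ⟦ proj₁ g ⟧ x

    -- Distinct positions of agreement correspond to distinct field elements, all roots of a
    -- polynomial of degree at most `d`; the remaining positions count towards the distance.
    hd-contraction : ∀ {d} → 3 ℕ.≤ d → Admissible d (v , u) → Admissible d (v′ , u′) → ¬ f ≍ g →
                     q ℕ.∸ d ℕ.≤ hd (contraction (toInverse f)) (contraction (toInverse g))
    hd-contraction {d} 3≤d adm adm′ f≭g with agreementPolynomial-degree 3≤d adm adm′ f≭g
    ... | n , T° , n≤d = ℕ.m≤n+o⇒m∸n≤o q d (begin
      q                            ≡⟨ List.length-tabulate {n = q} (λ i → i) ⟨
      length (allFin q)            ≡⟨ length-filter-¬? agree? (allFin q) ⟨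
      hd π σ ℕ.+ length agreements ≤⟨ ℕ.+-monoʳ-≤ (hd π σ) agreements≤d ⟩
      hd π σ ℕ.+ d                 ≡⟨ ℕ.+-comm (hd π σ) d ⟩
      d ℕ.+ hd π σ                 ∎)
      where
      open ℕ.≤-Reasoning
      π = contraction (toInverse f)
      σ = contraction (toInverse g)
      agree? : Decidable λ x → π ⟨$⟩ʳ x ≡ σ ⟨$⟩ʳ x
      agree? x = π ⟨$⟩ʳ x Fin.≟ σ ⟨$⟩ʳ x
      agreements = filter agree? (allFin q)
      to-injective : ∀ {x y} → Order.to x ≡ Order.to y → x ≈ y
      to-injective eq = trans (sym (Order.inverseʳ ≡.refl)) (Order.inverseʳ eq)
      from-injective : ∀ {i j} → Order.from i ≈ Order.from j → i ≡ j
      from-injective eq = ≡.trans (≡.sym (Order.inverseˡ refl)) (Order.inverseˡ eq)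
      agreements≤d : length agreements ℕ.≤ d
      agreements≤d = begin
        length agreements                        ≡⟨ List.length-map Order.from agreements ⟨
        length (List.map Order.from agreements)  ≤⟨ roots≤degree {agreementPolynomial} T°
          (Unique.map⁺ (≡.setoid (Fin q)) setoid from-injective
            (Uniqueₚ.filter⁺ agree? (Uniqueₚ.allFin⁺ q)))
          (All.map⁺ (All.map (λ eq → agreement⇒root _ (to-injective eq))
            (All.all-filter agree? (allFin q)))) ⟩
        n                                        ≤⟨ n≤d ⟩
        d                                        ∎

  -- The permutation array formed by all admissible PRFs.

  private
    Family : ℕ × ℕ → Set _
    Family (v , u) = PRF v u

    size : ℕ × ℕ → ℕ
    size (v , u) = N v u

    _~_ : ∃ Family → ∃ Family → Set ℓ
    (_ , f) ~ (_ , g) = f ≍ g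

    enumerate : ∀ k → Fin (size k) → Family k
    enumerate (v , u) = Inverse.from (proj₂ (PRFs-cardinality v u))

  -- Both indices equal the index that the cardinality bijection assigns to the function `f`.
  enumerate-injective : ∀ {k x y} → (k , enumerate k x) ~ (k , enumerate k y) → x ≡ y
  enumerate-injective {v , u} {x} {y} eq = ≡.trans
      (≡.sym (C.inverseˡ {x} {f} (≈ₚ-refl {num (proj₁ f) *ₚ den (proj₁ f)})))
      (C.inverseˡ {y} {f} eq)
    where
    open RationalFunction
    module C = Inverse (proj₂ (PRFs-cardinality v u))
    f = C.from x

  contractedPRFs : ∀ {d} → 3 ℕ.≤ d → d ℕ.+ 2 ℕ.≤ q → PermutationArray q (q ℕ.∸ d) (𝓢 d)
  contractedPRFs {d} 3≤d d+2≤q = π , record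
    -- Since d + 2 ≤ q, the distance q - d is positive, while equal permutations have distance 0.
    { distinct = λ i j i≢j π≈ → ℕ.<⇒≱ (ℕ.m<n⇒0<n∸m (ℕ.<-≤-trans (ℕ.m<m+n d (s≤s z≤n)) d+2≤q))
        (ℕ.≤-trans (far i j i≢j) (ℕ.≤-reflexive (≈⇒hd≡0 (π i) (π j) π≈)))
    ; distance = λ i j π≉ → far i j λ { ≡.refl → π≉ λ _ → ≡.refl }
    }
    where
    range = upTo (suc d)
    degrees = filter (admissible? d) (cartesianProduct range range)
    degrees! : Unique (≡.setoid (ℕ × ℕ)) degrees
    degrees! = Uniqueₚ.filter⁺ (admissible? d)
      (Uniqueₚ.cartesianProduct⁺ (Uniqueₚ.upTo⁺ (suc d)) (Uniqueₚ.upTo⁺ (suc d)))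
    prf : Fin (𝓢 d) → ∃ Family
    prf = select size enumerate degrees
    π : Fin (𝓢 d) → Permutation′ q
    π i = contraction (toInverse (proj₂ (prf i)))
    admissible : ∀ i → Admissible d (proj₁ (prf i))
    admissible i = All.lookup (All.all-filter (admissible? d) (cartesianProduct range range))
      (select-∈ size enumerate degrees i)
    far : ∀ i j → i ≢ j → q ℕ.∸ d ℕ.≤ hd (π i) (π j)
    far i j i≢j = hd-contraction (proj₂ (prf i)) (proj₂ (prf j)) 3≤d (admissible i) (admissible j)
      -- Equal rational functions would have the same degree pair, and then the same place in its
      -- enumeration.
      λ eq → i≢j (select-injective size enumerate {_~_ = _~_}
        (λ {(_ , f)} {(_ , g)} → ≍⇒degrees≡ f g)
        (λ {k} → enumerate-injective {k}) degrees! i j eq)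
    ≈⇒hd≡0 : (ρ σ : Permutation′ q) → ρ Perm.≈ σ → hd ρ σ ≡ 0
    ≈⇒hd≡0 ρ σ ρ≈σ = ≡.cong length (List.filter-none (λ x → ¬? (ρ ⟨$⟩ʳ x Fin.≟ σ ⟨$⟩ʳ x))
      (All.universal (λ x ¬eq → ¬eq (ρ≈σ x)) (allFin q)))

open import Data.Nat using (ℕ; _+_; _∸_; _≤_; _≥_)
open import Data.Nat.Divisibility using (_∣_)

theorem4p5 : ∀ {c ℓ} (d q : ℕ) → ¬ (2 ∣ d) → d ≥ 3 → PrimePower q → q ≥ d + 2 →
    (F : FiniteField c ℓ q) → M q (q ∸ d) ≥ RationalFunctions.𝓢 F d
theorem4p5 d q _ 3≤d _ d+2≤q F = proj₂ (proj₂ (maximumSize q (q ∸ d))) _ (contractedPRFs F 3≤d d+2≤q)
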